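{- Let $\epsilon>0$ be a constant. Let $d,k,t$ be integers with $d<2^{\epsilon k/5}$ and $t<\frac{\epsilon}{5}k^{d-1}$. Let $\{x^{(i,j)}\}_{i\in[t],j\in[d]}$ be independent and uniformly distributed in $\mathbb{F}_2^k$. Then $$\Pr\left[\sum_{i=1}^t\bigotimes_{j=1}^d x^{(i,j)}=0\right]\le 2^{ -(1-\epsilon/2)kt}.$$
   Context: For vectors $u_1,\dots,u_d\in\mathbb{F}_2^k$, $\bigotimes_{j=1}^d u_j$ denotes the tensor $[k]^d\to\mathbb{F}_2$, $(i_1,\dots,i_d)\mapsto u_{1,i_1}\cdots u_{d,i_d}$ (an element of $(\mathbb{F}_2^k)^{\otimes d}\cong\mathbb{F}_2^{k^d}$); the sum is entrywise over $\mathbb{F}_2$. -}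

module Defs where

open import Data.Nat using (ℕ; zero; suc)
open import Data.Bool using (Bool; true; false; _∧_; _xor_; not)
open import Data.Fin using (Fin; zero; suc)
open import Data.List using (List; []; _∷_; map; concatMap; length; filterᵇ)

-- Vectors in 𝔽₂^k : 𝔽₂ is Bool with xor as + and ∧ as ·.
Bits : ℕ → Set
Bits k = Fin k → Bool

prodF : ∀ {n} → (Fin n → Bool) → Bool
prodF {zero}  f = true
prodF {suc n} f = f zero ∧ prodF (λ i → f (suc i))

sumF : ∀ {n} → (Fin n → Bool) → Bool
sumF {zero}  f = false
sumF {suc n} f = f zero xor sumF (λ i → f (suc i))

tensor : ∀ {d k} → (Fin d → Bits k) → (Fin d → Fin k) → Bool
tensor u idx = prodF (λ j → u j (idx j))

tensorSum : ∀ {t d k} → (Fin t → Fin d → Bits k) → (Fin d → Fin k) → Bool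
tensorSum x idx = sumF (λ i → tensor (x i) idx)

allFuns : ∀ {a} {A : Set a} (n : ℕ) → List A → List (Fin n → A)
allFuns zero    xs = (λ ()) ∷ []
allFuns (suc n) xs =
  concatMap (λ a → map (λ f → λ { zero → a ; (suc i) → f i }) (allFuns n xs)) xs

allIndices : (d k : ℕ) → List (Fin d → Fin k)
allIndices d k = allFuns d (Data.List.allFin k)
  where import Data.List

allBits : (k : ℕ) → List (Bits k)
allBits k = allFuns k (true ∷ false ∷ [])

allᵇ : ∀ {a} {A : Set a} → (A → Bool) → List A → Bool
allᵇ p []       = true
allᵇ p (x ∷ xs) = p x ∧ allᵇ p xs

isZeroTensor : ∀ {d k} → ((Fin d → Fin k) → Bool) → Bool
isZeroTensor {d} {k} T = allᵇ (λ idx → not (T idx)) (allIndices d k)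

samples : (t d k : ℕ) → List (Fin t → Fin d → Bits k)
samples t d k = allFuns t (allFuns d (allBits k))

-- number of families with ∑_i ⊗_j x^{(i,j)} = 0;
-- the probability in the paper is zeroCount t d k / 2^{k d t}
zeroCount : (t d k : ℕ) → ℕ
zeroCount t d k = length (filterᵇ (λ x → isZeroTensor (tensorSum x)) (samples t d k))

module Submission where

-- Fix d - 1 of the d factors and let yₛ be their tensor product in 𝔽₂^N, N = k^(d-1). Given the y's,
-- ∑ₛ xₛ ⊗ yₛ = 0 has probability 2^(-k rank y), so it suffices that a uniform pure tensor lies in a
-- subspace of dimension D ≤ t with small probability p. For tensors with nonzero factors, induction
-- on the order gives 1 + (2^k - 1) p ≤ 2^(k D / N): for a random first factor x, the dimension of
-- { v | x ⊗ v ∈ U } is at most the number of layers of U (taken along the other coordinates) that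
-- contain x, and Hölder's inequality over the layers decouples them, leaving the equality case
-- "order one" in each layer. All roots are replaced by powers of a rational u / n with
-- (u / n)^N slightly below 2^k, so that everything is stated over ℕ.

-- The layers are dependent, since one `x` may hit all of them, so Hölder's inequality is applied
-- with the number `K = k ^ m` of layers as exponent. Ideally this loses nothing: for
-- `(u / n) ^ K = 2`, the mean over nonzero `x` of `2 ^ k` on an image of dimension `r` and `1` off
-- it is exactly `2 ^ r`, for every `r`. A rational `u / n` only makes the base at most 2, and the
-- equality becomes the inequality `layer-ineq`.
--
-- Adding the summands one by one, each costs a factor `4/3 * (m + (u / n) ^ t)` on top of the ideal
-- `2 ^ (-k)`. With ε = p / q and m = d - 1, the two hypotheses bound both terms by `2 ^ (εk/5)`.
-- The remaining constant is 8/3 < 2^(3/2), and `2 ≤ 2 ^ (εk/5)` bounds it by `2 ^ (3εk/10)`. The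
-- loss 1/2 in the theorem is 1/5 + 3/10.

open import Defs
open import Level using (Level)
open import Data.Nat.Properties hiding (_≟_)
open import Algebra.Properties.CommutativeSemigroup +-commutativeSemigroup
  using () renaming (interchange to +-interchange)
open import Algebra.Properties.CommutativeSemigroup *-commutativeSemigroup
  using (x∙yz≈y∙xz) renaming (interchange to *-interchange)
open import Data.Bool using (Bool; true; false; _∧_; _xor_; not; if_then_else_)
open import Data.Bool.Properties
  using (_≟_; ¬-not; not-injective; xor-same; xor-comm; xor-assoc; not-distribˡ-xor; not-distribʳ-xor;
         xor-annihilates-not; ∧-assoc; ∧-distribʳ-xor; ∧-distribˡ-xor; ∧-identityʳ; ∧-zeroʳ)
open import Data.Fin using (Fin; zero; suc)
open import Data.Fin.Properties using (all?)
open import Data.List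
  using (List; []; _∷_; _++_; map; concatMap; length; tabulate; allFin; filterᵇ)
open import Data.List.Properties using (length-++; length-map; length-tabulate; map-++; map-tabulate)
open import Data.List.Relation.Unary.All using (All; []; _∷_)
import Data.List.Relation.Unary.All as All
import Data.List.Relation.Unary.All.Properties as All
open import Data.Nat
  using (ℕ; zero; suc; _+_; _*_; _∸_; _^_; _≤_; _<_; z≤n; s≤s; NonZero; >-nonZero; >-nonZero⁻¹)
open import Data.Nat.Tactic.RingSolver using (solve-∀)
open import Data.Product using (∃; _×_; _,_; proj₁; proj₂)
open import Data.Sum using (_⊎_; inj₁; inj₂; [_,_]; [_,_]′)
open import Data.Unit using (⊤; tt)
import Data.Vec as Vec
open import Data.Vec using (Vec; []; _∷_; lookup; replicate; zipWith)
open import Data.Vec.Properties using (lookup-zipWith; lookup∘tabulate)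
open import Function using (_∘_)
open import Relation.Binary.PropositionalEquality
  using (_≡_; _≗_; refl; sym; trans; cong; cong₂; subst; subst₂; module ≡-Reasoning)
open import Relation.Nullary using (¬_; Dec; yes; no; contradiction; map′; _×-dec_; _⊎-dec_)

private variable
  a b : Level
  A B : Set a
  k m s t : ℕ

-- Finite sums, AM-GM and Hölder

∑ : {A : Set a} → List A → (A → ℕ) → ℕ
∑ []       g = 0
∑ (x ∷ xs) g = g x + ∑ xs g

∏ : {A : Set a} → List A → (A → ℕ) → ℕ
∏ []       g = 1
∏ (x ∷ xs) g = g x * ∏ xs g

∑-++ : (xs ys : List A) (g : A → ℕ) → ∑ (xs ++ ys) g ≡ ∑ xs g + ∑ ys g
∑-++ []       ys g = refl
∑-++ (x ∷ xs) ys g = trans (cong (g x +_) (∑-++ xs ys g)) (sym (+-assoc (g x) _ _))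

∑-map : (h : A → B) (xs : List A) (g : B → ℕ) → ∑ (map h xs) g ≡ ∑ xs (g ∘ h)
∑-map h []       g = refl
∑-map h (x ∷ xs) g = cong (g (h x) +_) (∑-map h xs g)

∑-cong : (xs : List A) {g h : A → ℕ} → (∀ x → g x ≡ h x) → ∑ xs g ≡ ∑ xs h
∑-cong []       eq = refl
∑-cong (x ∷ xs) eq = cong₂ _+_ (eq x) (∑-cong xs eq)

∑-concatMap : (h : A → List B) (xs : List A) (g : B → ℕ) →
  ∑ (concatMap h xs) g ≡ ∑ xs (λ x → ∑ (h x) g)
∑-concatMap h []       g = refl
∑-concatMap h (x ∷ xs) g =
  trans (∑-++ (h x) _ g) (cong (∑ (h x) g +_) (∑-concatMap h xs g))

∑-mono-All : {xs : List A} {g h : A → ℕ} → All (λ x → g x ≤ h x) xs → ∑ xs g ≤ ∑ xs h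
∑-mono-All []       = z≤n
∑-mono-All (p ∷ ps) = +-mono-≤ p (∑-mono-All ps)

∑-mono : (xs : List A) {g h : A → ℕ} → (∀ x → g x ≤ h x) → ∑ xs g ≤ ∑ xs h
∑-mono []       le = z≤n
∑-mono (x ∷ xs) le = +-mono-≤ (le x) (∑-mono xs le)

∑-+ : (xs : List A) (g h : A → ℕ) → ∑ xs (λ x → g x + h x) ≡ ∑ xs g + ∑ xs h
∑-+ []       g h = refl
∑-+ (x ∷ xs) g h =
  trans (cong (g x + h x +_) (∑-+ xs g h)) (+-interchange (g x) (h x) _ _)

∑-*ˡ : (c : ℕ) (xs : List A) (g : A → ℕ) → ∑ xs (λ x → c * g x) ≡ c * ∑ xs g
∑-*ˡ c []       g = sym (*-zeroʳ c)
∑-*ˡ c (x ∷ xs) g = trans (cong (c * g x +_) (∑-*ˡ c xs g)) (sym (*-distribˡ-+ c (g x) _))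

∑-const : (xs : List A) (c : ℕ) → ∑ xs (λ _ → c) ≡ length xs * c
∑-const []       c = refl
∑-const (x ∷ xs) c = cong (c +_) (∑-const xs c)

∑-swap : (xs : List A) (ys : List B) (g : A → B → ℕ) →
  ∑ xs (λ x → ∑ ys (g x)) ≡ ∑ ys (λ y → ∑ xs (λ x → g x y))
∑-swap []       ys g = sym (trans (∑-const ys 0) (*-zeroʳ (length ys)))
∑-swap (x ∷ xs) ys g =
  trans (cong (∑ ys (g x) +_) (∑-swap xs ys g)) (sym (∑-+ ys (g x) _))

∏-* : (xs : List A) (g h : A → ℕ) → ∏ xs (λ x → g x * h x) ≡ ∏ xs g * ∏ xs h
∏-* []       g h = refl
∏-* (x ∷ xs) g h =
  trans (cong (g x * h x *_) (∏-* xs g h)) (*-interchange (g x) (h x) _ _)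

∏-const : (xs : List A) (c : ℕ) → ∏ xs (λ _ → c) ≡ c ^ length xs
∏-const []       c = refl
∏-const (x ∷ xs) c = cong (c *_) (∏-const xs c)

∏-cong-All : {xs : List A} {g h : A → ℕ} → All (λ x → g x ≡ h x) xs → ∏ xs g ≡ ∏ xs h
∏-cong-All []       = refl
∏-cong-All (p ∷ ps) = cong₂ _*_ p (∏-cong-All ps)

^-distribʳ-* : ∀ m n o → (m * n) ^ o ≡ m ^ o * n ^ o
^-distribʳ-* m n zero    = refl
^-distribʳ-* m n (suc o) =
  trans (cong (m * n *_) (^-distribʳ-* m n o)) (*-interchange m n (m ^ o) (n ^ o))

^-comm : ∀ m n o → (m ^ n) ^ o ≡ (m ^ o) ^ n
^-comm m n o = trans (^-*-assoc m n o) (trans (cong (m ^_) (*-comm n o)) (sym (^-*-assoc m o n)))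

^-cancelʳ-≤ : ∀ {m n} o .{{_ : NonZero o}} → m ^ o ≤ n ^ o → m ≤ n
^-cancelʳ-≤ {m} {n} o le = ≮⇒≥ λ n<m → <⇒≱ (^-monoˡ-< o n<m) le

module _ where
  open ≤-Reasoning

  square-ineq : ∀ x y → x * y + x * y ≤ x * x + y * y
  square-ineq zero    y       = z≤n
  square-ineq (suc x) zero    rewrite *-zeroʳ x = z≤n
  square-ineq (suc x) (suc y) = begin
    suc x * suc y + suc x * suc y        ≡⟨ l x y ⟩
    (x * y + x * y) + (2 + 2 * x + 2 * y)  ≤⟨ +-monoˡ-≤ _ (square-ineq x y) ⟩
    (x * x + y * y) + (2 + 2 * x + 2 * y)  ≡⟨ r x y ⟩
    suc x * suc x + suc y * suc y ∎
    where
    l : ∀ x y → suc x * suc y + suc x * suc y ≡ (x * y + x * y) + (2 + 2 * x + 2 * y)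
    l = solve-∀
    r : ∀ x y → (x * x + y * y) + (2 + 2 * x + 2 * y) ≡ suc x * suc x + suc y * suc y
    r = solve-∀

  -- AM-GM for `n` copies of `a` and one `c`. In the induction, `2ac ≤ a² + c²` produces `c` times
  -- the previous case; the mixed term that this leaves over is added to both sides beforehand.
  young : ∀ n a c → suc n * (c * a ^ n) ≤ n * a ^ suc n + c ^ suc n
  young zero    a c = ≤-reflexive (+-identityʳ (c * 1))
  young (suc n) a c = +-cancelʳ-≤ (n * (a * a ^ n) * c) _ _ (begin
    suc (suc n) * (c * (a * a ^ n)) + n * (a * a ^ n) * c
      ≡⟨ e₁ n a c (a ^ n) ⟩
    suc n * (a ^ n * (a * c + a * c))
      ≤⟨ *-monoʳ-≤ (suc n) (*-monoʳ-≤ (a ^ n) (square-ineq a c)) ⟩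
    suc n * (a ^ n * (a * a + c * c))
      ≡⟨ e₂ n a c (a ^ n) ⟩
    suc n * (a * (a * a ^ n)) + c * (suc n * (c * a ^ n))
      ≤⟨ +-monoʳ-≤ (suc n * (a * (a * a ^ n))) (*-monoʳ-≤ c (young n a c)) ⟩
    suc n * (a * (a * a ^ n)) + c * (n * (a * a ^ n) + c * c ^ n)
      ≡⟨ e₃ n a c (a ^ n) (c ^ n) ⟩
    suc n * (a * (a * a ^ n)) + c * (c * c ^ n) + n * (a * a ^ n) * c ∎)
    where
    e₁ : ∀ n a c p → suc (suc n) * (c * (a * p)) + n * (a * p) * c ≡ suc n * (p * (a * c + a * c))
    e₁ = solve-∀
    e₂ : ∀ n a c p → suc n * (p * (a * a + c * c)) ≡ suc n * (a * (a * p)) + c * (suc n * (c * p))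
    e₂ = solve-∀
    e₃ : ∀ n a c p q → suc n * (a * (a * p)) + c * (n * (a * p) + c * q)
       ≡ suc n * (a * (a * p)) + c * (c * q) + n * (a * p) * c
    e₃ = solve-∀

  ∑-young : (xs : List A) (g : A → ℕ) (n c : ℕ) →
    suc n * (c * ∑ xs (λ x → g x ^ n)) ≤ n * ∑ xs (λ x → g x ^ suc n) + length xs * c ^ suc n
  ∑-young []       g n c = ≤-trans (≤-reflexive (trans (cong (suc n *_) (*-zeroʳ c)) (*-zeroʳ (suc n)))) z≤n
  ∑-young (x ∷ xs) g n c = begin
    suc n * (c * (g x ^ n + ∑ xs _))
      ≡⟨ e₁ n c (g x ^ n) _ ⟩
    suc n * (c * g x ^ n) + suc n * (c * ∑ xs _)
      ≤⟨ +-mono-≤ (young n (g x) c) (∑-young xs g n c) ⟩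
    (n * g x ^ suc n + c ^ suc n) + (n * ∑ xs _ + length xs * c ^ suc n)
      ≡⟨ e₂ n (g x ^ suc n) (c ^ suc n) _ _ ⟩
    n * (g x ^ suc n + ∑ xs _) + suc (length xs) * c ^ suc n ∎
    where
    e₁ : ∀ n c p q → suc n * (c * (p + q)) ≡ suc n * (c * p) + suc n * (c * q)
    e₁ = solve-∀
    e₂ : ∀ n p q r s → (n * p + q) + (n * r + s) ≡ n * (p + r) + (q + s)
    e₂ = solve-∀

  -- Stated with powers instead of roots. For a new factor `c`, the induction hypothesis replaces
  -- the product by a sum of `n`-th powers, and `young` turns each `c * g x ^ n` into pure powers.
  am-gm : (xs : List A) (g : A → ℕ) → length xs * ∏ xs g ≤ ∑ xs (λ x → g x ^ length xs)
  am-gm []                g = z≤n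
  am-gm (x ∷ [])          g = ≤-refl
  am-gm (x ∷ xs@(_ ∷ _)) g = *-cancelˡ-≤ n (begin
    n * (suc n * (c * ∏ xs g))
      ≡⟨ e₁ n c (∏ xs g) ⟩
    suc n * (c * (n * ∏ xs g))
      ≤⟨ *-monoʳ-≤ (suc n) (*-monoʳ-≤ c (am-gm xs g)) ⟩
    suc n * (c * ∑ xs (λ x → g x ^ n))
      ≤⟨ ∑-young xs g n c ⟩
    n * ∑ xs (λ x → g x ^ suc n) + n * c ^ suc n
      ≡⟨ e₂ n _ (c ^ suc n) ⟩
    n * (c ^ suc n + ∑ xs (λ x → g x ^ suc n)) ∎)
    where
    n = length xs
    c = g x
    e₁ : ∀ n c p → n * (suc n * (c * p)) ≡ suc n * (c * (n * p))
    e₁ = solve-∀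
    e₂ : ∀ n p q → n * p + n * q ≡ n * (q + p)
    e₂ = solve-∀

  -- Ḡ clears the denominators 1/G of the AM-GM step.
  hölder : {Z : Set a} {X : Set b} (zs : List Z) (xs : List X) .{{n≢0 : NonZero (length zs)}}
    (F : Z → X → ℕ) (G Ḡ : Z → ℕ) (E S : ℕ) .{{_ : NonZero E}} →
    All (λ z → G z * Ḡ z ≡ E) zs →
    All (λ z → ∑ xs (λ x → F z x ^ length zs) ≤ S * G z ^ length zs) zs →
    ∑ xs (λ x → ∏ zs (λ z → F z x)) ≤ S * ∏ zs G
  hölder zs xs {{n≢0}} F G Ḡ E S GḠ≡E bound =
    *-cancelʳ-≤ _ _ (n * E ^ n) {{m*n≢0 n (E ^ n) {{n≢0}} {{m^n≢0 E n}}}} (begin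
    ∑ xs (λ x → ∏ zs (λ z → F z x)) * (n * E ^ n)
      ≡⟨ cong (λ e → ∑ xs (λ x → ∏ zs (λ z → F z x)) * (n * e)) (sym ∏GḠ) ⟩
    ∑ xs (λ x → ∏ zs (λ z → F z x)) * (n * (∏ zs G * ∏ zs Ḡ))
      ≡⟨ e₁ _ n (∏ zs G) (∏ zs Ḡ) ⟩
    ∏ zs G * (n * ∏ zs Ḡ * ∑ xs (λ x → ∏ zs (λ z → F z x)))
      ≤⟨ *-monoʳ-≤ (∏ zs G) main ⟩
    ∏ zs G * (S * (n * E ^ n))
      ≡⟨ e₂ (∏ zs G) S _ ⟩
    S * ∏ zs G * (n * E ^ n) ∎)
    where
    n = length zs
    e₁ : ∀ x n g h → x * (n * (g * h)) ≡ g * (n * h * x)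
    e₁ = solve-∀
    e₂ : ∀ x n g → x * (n * g) ≡ n * x * g
    e₂ = solve-∀
    e₃ : ∀ n h f → n * h * f ≡ n * (f * h)
    e₃ = solve-∀
    ∏GḠ : ∏ zs G * ∏ zs Ḡ ≡ E ^ n
    ∏GḠ = trans (sym (∏-* zs G Ḡ)) (trans (∏-cong-All GḠ≡E) (∏-const zs E))
    layers : ∀ {ws} → All (λ z → G z * Ḡ z ≡ E) ws →
      All (λ z → ∑ xs (λ x → F z x ^ n) ≤ S * G z ^ n) ws →
      ∑ ws (λ z → ∑ xs (λ x → (F z x * Ḡ z) ^ n)) ≤ length ws * (S * E ^ n)
    layers []       []       = z≤n
    layers {z ∷ ws} (q ∷ qs) (p ∷ ps) = +-mono-≤ (begin
      ∑ xs (λ x → (F z x * Ḡ z) ^ n)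
        ≡⟨ ∑-cong xs (λ x → trans (^-distribʳ-* (F z x) (Ḡ z) n) (*-comm (F z x ^ n) _)) ⟩
      ∑ xs (λ x → Ḡ z ^ n * F z x ^ n)
        ≡⟨ ∑-*ˡ (Ḡ z ^ n) xs _ ⟩
      Ḡ z ^ n * ∑ xs (λ x → F z x ^ n)
        ≤⟨ *-monoʳ-≤ (Ḡ z ^ n) p ⟩
      Ḡ z ^ n * (S * G z ^ n)
        ≡⟨ e₄ (Ḡ z ^ n) S (G z ^ n) ⟩
      S * (G z ^ n * Ḡ z ^ n)
        ≡⟨ cong (S *_) (trans (sym (^-distribʳ-* (G z) (Ḡ z) n)) (cong (_^ n) q)) ⟩
      S * E ^ n ∎) (layers qs ps)
      where
      e₄ : ∀ h s g → h * (s * g) ≡ s * (g * h)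
      e₄ = solve-∀
    main : n * ∏ zs Ḡ * ∑ xs (λ x → ∏ zs (λ z → F z x)) ≤ S * (n * E ^ n)
    main = begin
      n * ∏ zs Ḡ * ∑ xs (λ x → ∏ zs (λ z → F z x))
        ≡⟨ sym (∑-*ˡ (n * ∏ zs Ḡ) xs _) ⟩
      ∑ xs (λ x → n * ∏ zs Ḡ * ∏ zs (λ z → F z x))
        ≡⟨ ∑-cong xs (λ x → trans (e₃ n (∏ zs Ḡ) _) (cong (n *_) (sym (∏-* zs (λ z → F z x) Ḡ)))) ⟩
      ∑ xs (λ x → n * ∏ zs (λ z → F z x * Ḡ z))
        ≤⟨ ∑-mono xs (λ x → am-gm zs (λ z → F z x * Ḡ z)) ⟩
      ∑ xs (λ x → ∑ zs (λ z → (F z x * Ḡ z) ^ n))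
        ≡⟨ ∑-swap xs zs _ ⟩
      ∑ zs (λ z → ∑ xs (λ x → (F z x * Ḡ z) ^ n))
        ≤⟨ layers GḠ≡E bound ⟩
      n * (S * E ^ n)
        ≡⟨ e₅ n S _ ⟩
      S * (n * E ^ n) ∎
      where
      e₅ : ∀ n s e → n * (s * e) ≡ s * (n * e)
      e₅ = solve-∀

  -- With b = U/V ∈ [1,2] this is 1 + (b^k - 1)(2^d - 1)/(2^k - 1) ≤ b^d for k = d + j, cleared of
  -- denominators and of subtractions; layer-ineq₀ is the estimate for a single increment of j.
  layer-ineq₀ : ∀ d V w → w ≤ V →
    2 ^ d * ((V + w) ^ d * w) + 2 ^ d * V ^ suc d ≤ 2 ^ d * (V * (V + w) ^ d) + (V + w) ^ d * w
  layer-ineq₀ zero    V w w≤V = ≤-reflexive (e V w)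
    where
    e : ∀ V w → 1 * (1 * w) + 1 * (V * 1) ≡ 1 * (V * 1) + 1 * w
    e = solve-∀
  -- For `b > 1` the claim says that the sum of `2 ^ (-i)` over `1 ≤ i ≤ d` is at most the sum of
  -- `b ^ (-i)`.
  layer-ineq₀ (suc d) V w w≤V = begin
    2 * T * (U * P * w) + 2 * T * (V * (V * Q))
      ≡⟨ e₁ T V w P Q ⟩
    2 * V * (T * (P * w) + T * (V * Q)) + P * w * (2 * T * w)
      ≤⟨ +-monoˡ-≤ _ (*-monoʳ-≤ (2 * V) (layer-ineq₀ d V w w≤V)) ⟩
    2 * V * (T * (V * P) + P * w) + P * w * (2 * T * w)
      ≡⟨ e₂ T V w P ⟩
    2 * T * (V * (V * P)) + V * P * w + P * w * (V + 2 * T * w)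
      ≤⟨ +-monoʳ-≤ (2 * T * (V * (V * P)) + V * P * w)
           (*-monoʳ-≤ (P * w) (slack (2 * T) (m^n>0 2 (suc d)))) ⟩
    2 * T * (V * (V * P)) + V * P * w + P * w * (2 * T * V + w)
      ≡⟨ e₃ T V w P ⟩
    2 * T * (V * (U * P)) + U * P * w ∎
    where
    U = V + w
    P = U ^ d
    Q = V ^ d
    T = 2 ^ d
    e₁ : ∀ T V w P Q → 2 * T * ((V + w) * P * w) + 2 * T * (V * (V * Q))
       ≡ 2 * V * (T * (P * w) + T * (V * Q)) + P * w * (2 * T * w)
    e₁ = solve-∀
    e₂ : ∀ T V w P → 2 * V * (T * (V * P) + P * w) + P * w * (2 * T * w)
       ≡ 2 * T * (V * (V * P)) + V * P * w + P * w * (V + 2 * T * w)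
    e₂ = solve-∀
    e₃ : ∀ T V w P → 2 * T * (V * (V * P)) + V * P * w + P * w * (2 * T * V + w)
       ≡ 2 * T * (V * ((V + w) * P)) + (V + w) * P * w
    e₃ = solve-∀
    -- This is `(M - 1) * (V - w) ≥ 0` without subtraction; here `b ≤ 2` enters.
    slack : ∀ M → 1 ≤ M → V + M * w ≤ M * V + w
    slack (suc s) _ = begin
      V + (w + s * w) ≡⟨ e₄ V w (s * w) ⟩
      V + s * w + w   ≤⟨ +-monoˡ-≤ w (+-monoʳ-≤ V (*-monoʳ-≤ s w≤V)) ⟩
      V + s * V + w   ∎
      where
      e₄ : ∀ x y z → x + (y + z) ≡ x + z + y
      e₄ = solve-∀

  layer-ineq : ∀ d j V w → w ≤ V → let U = V + w in
    2 ^ d * U ^ (d + j) + 2 ^ (d + j) * V ^ (d + j) + U ^ d * V ^ j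
      ≤ 2 ^ (d + j) * (U ^ d * V ^ j) + 2 ^ d * V ^ (d + j) + U ^ (d + j)
  layer-ineq d zero    V w w≤V rewrite +-identityʳ d =
    ≤-reflexive (e (2 ^ d) ((V + w) ^ d) (V ^ d))
    where
    e : ∀ T P Q → T * P + T * Q + P * 1 ≡ T * (P * 1) + T * Q + P
    e = solve-∀
  layer-ineq d (suc j) V w w≤V rewrite +-suc d j
    | ^-distribˡ-+-* 2 d j | ^-distribˡ-+-* (V + w) d j | ^-distribˡ-+-* V d j =
    begin
    T * (U * (P * R)) + 2 * (T * J) * (V * (Q * S)) + P * (V * S)
      ≡⟨ e₁ T J V w P Q R S ⟩
    (T * (P * R) + T * J * (Q * S) + P * S) * V + (T * (P * w) * R + T * J * (V * Q) * S)
      ≤⟨ +-mono-≤ (*-monoˡ-≤ V ih) incr ⟩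
    (T * J * (P * S) + T * (Q * S) + P * R) * V + (T * J * (V * P) * S + P * w * R)
      ≡⟨ e₂ T J V w P Q R S ⟩
    2 * (T * J) * (P * (V * S)) + T * (V * (Q * S)) + U * (P * R) ∎
    where
    U = V + w
    T = 2 ^ d
    J = 2 ^ j
    P = U ^ d
    Q = V ^ d
    R = U ^ j
    S = V ^ j
    ih : T * (P * R) + T * J * (Q * S) + P * S ≤ T * J * (P * S) + T * (Q * S) + P * R
    ih = subst₂ _≤_
      (cong₂ (λ x y → T * x + y + P * S) (^-distribˡ-+-* U d j)
        (cong₂ _*_ (^-distribˡ-+-* 2 d j) (^-distribˡ-+-* V d j)))
      (cong₂ _+_ (cong₂ (λ x y → x * (P * S) + T * y) (^-distribˡ-+-* 2 d j) (^-distribˡ-+-* V d j))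
        (^-distribˡ-+-* U d j))
      (layer-ineq d j V w w≤V)
    R≤JS : R ≤ J * S
    R≤JS = begin
      (V + w) ^ j  ≤⟨ ^-monoˡ-≤ j (+-monoʳ-≤ V w≤V) ⟩
      (V + V) ^ j  ≡⟨ cong (λ v → (V + v) ^ j) (sym (+-identityʳ V)) ⟩
      (2 * V) ^ j  ≡⟨ ^-distribʳ-* 2 V j ⟩
      2 ^ j * V ^ j ∎
    -- Splitting `J * S` as `R + z` leaves `layer-ineq₀` for the multiples of `R`, while `V ≤ U`
    -- suffices for the multiples of `z`.
    incr : T * (P * w) * R + T * J * (V * Q) * S ≤ T * J * (V * P) * S + P * w * R
    incr with z , JS≡R+z ← m≤n⇒∃[o]m+o≡n R≤JS = begin
      T * (P * w) * R + T * J * (V * Q) * S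
        ≡⟨ e₃ (T * (P * w) * R) T J V Q S ⟩
      T * (P * w) * R + T * (V * Q) * (J * S)
        ≡⟨ cong (λ y → T * (P * w) * R + T * (V * Q) * y) (sym JS≡R+z) ⟩
      T * (P * w) * R + T * (V * Q) * (R + z)
        ≡⟨ e₄ (T * (P * w)) (T * (V * Q)) R z ⟩
      (T * (P * w) + T * (V * Q)) * R + T * (V * Q) * z
        ≤⟨ +-mono-≤ (*-monoˡ-≤ R (layer-ineq₀ d V w w≤V))
             (*-monoˡ-≤ z (*-monoʳ-≤ T (*-monoʳ-≤ V (^-monoˡ-≤ d (m≤m+n V w))))) ⟩
      (T * (V * P) + P * w) * R + T * (V * P) * z
        ≡⟨ e₅ (T * (V * P)) (P * w) R z ⟩
      T * (V * P) * (R + z) + P * w * R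
        ≡⟨ cong (λ y → T * (V * P) * y + P * w * R) JS≡R+z ⟩
      T * (V * P) * (J * S) + P * w * R
        ≡⟨ e₆ T J (V * P) S (P * w * R) ⟩
      T * J * (V * P) * S + P * w * R ∎
      where
      e₃ : ∀ x T J V Q S → x + T * J * (V * Q) * S ≡ x + T * (V * Q) * (J * S)
      e₃ = solve-∀
      e₄ : ∀ a b r z → a * r + b * (r + z) ≡ (a + b) * r + b * z
      e₄ = solve-∀
      e₅ : ∀ c d r z → (c + d) * r + c * z ≡ c * (r + z) + d * r
      e₅ = solve-∀
      e₆ : ∀ T J V S x → T * V * (J * S) + x ≡ T * J * V * S + x
      e₆ = solve-∀
    e₁ : ∀ T J V w P Q R S → T * ((V + w) * (P * R)) + 2 * (T * J) * (V * (Q * S)) + P * (V * S)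
      ≡ (T * (P * R) + T * J * (Q * S) + P * S) * V + (T * (P * w) * R + T * J * (V * Q) * S)
    e₁ = solve-∀
    e₂ : ∀ T J V w P Q R S →
      (T * J * (P * S) + T * (Q * S) + P * R) * V + (T * J * (V * P) * S + P * w * R)
      ≡ 2 * (T * J) * (P * (V * S)) + T * (V * (Q * S)) + (V + w) * (P * R)
    e₂ = solve-∀

-- Subspaces of 𝔽₂^s and their images under linear functionals

_⊕_ : Vec Bool k → Vec Bool k → Vec Bool k
_⊕_ = zipWith _xor_

0⊕ : (v : Vec Bool k) → replicate k false ⊕ v ≡ v
0⊕ []      = refl
0⊕ (a ∷ v) = cong (a ∷_) (0⊕ v)

⊕-cancelʳ : (v w : Vec Bool k) → (v ⊕ w) ⊕ w ≡ v
⊕-cancelʳ []      []      = refl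
⊕-cancelʳ (a ∷ v) (b ∷ w) = cong₂ _∷_
  (trans (xor-assoc a b b) (trans (cong (a xor_) (xor-same b)) (xor-comm a false)))
  (⊕-cancelʳ v w)

-- Defined mutually so that the zero vector comes first in `vectors`: a zero factor is always
-- treated apart from the nonzero ones.
nonzeros vectors : (k : ℕ) → List (Vec Bool k)
nonzeros zero    = []
nonzeros (suc k) = map (false ∷_) (nonzeros k) ++ map (true ∷_) (vectors k)
vectors zero    = [] ∷ []
vectors (suc k) = replicate (suc k) false ∷ nonzeros (suc k)

∑-vectors : ∀ k (g : Vec Bool k → ℕ) → ∑ (vectors k) g ≡ g (replicate k false) + ∑ (nonzeros k) g
∑-vectors zero    g = refl
∑-vectors (suc k) g = refl

∑-nonzeros-suc : ∀ k (g : Vec Bool (suc k) → ℕ) →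
  ∑ (nonzeros (suc k)) g ≡ ∑ (nonzeros k) (g ∘ (false ∷_)) + ∑ (vectors k) (g ∘ (true ∷_))
∑-nonzeros-suc k g = trans (∑-++ (map (false ∷_) (nonzeros k)) _ g)
  (cong₂ _+_ (∑-map (false ∷_) (nonzeros k) g) (∑-map (true ∷_) (vectors k) g))

∑-vectors-suc : ∀ k (g : Vec Bool (suc k) → ℕ) →
  ∑ (vectors (suc k)) g ≡ ∑ (vectors k) (g ∘ (false ∷_)) + ∑ (vectors k) (g ∘ (true ∷_))
∑-vectors-suc k g = trans (cong (g (replicate (suc k) false) +_) (∑-nonzeros-suc k g))
  (trans (sym (+-assoc (g (replicate (suc k) false)) _ _))
    (cong (_+ ∑ (vectors k) (g ∘ (true ∷_))) (sym (∑-vectors k (g ∘ (false ∷_))))))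

length-vectors : ∀ k → length (vectors k) ≡ 2 ^ k
length-vectors k = trans (sym (trans (∑-const (vectors k) 1) (*-identityʳ _))) (count k)
  where
  count : ∀ k → ∑ (vectors k) (λ _ → 1) ≡ 2 ^ k
  count zero    = refl
  count (suc k) = trans (∑-vectors-suc k (λ _ → 1))
    (cong₂ _+_ (count k) (trans (count k) (sym (+-identityʳ _))))

length-nonzeros : ∀ k → suc (length (nonzeros k)) ≡ 2 ^ k
length-nonzeros zero    = refl
length-nonzeros (suc k) = length-vectors (suc k)

∑-translate : (v : Vec Bool k) (g : Vec Bool k → ℕ) →
  ∑ (vectors k) (λ x → g (x ⊕ v)) ≡ ∑ (vectors k) g
∑-translate []                  g = refl
∑-translate {suc k} (false ∷ v) g = trans (∑-vectors-suc k _)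
  (trans (cong₂ _+_ (∑-translate v _) (∑-translate v _)) (sym (∑-vectors-suc k g)))
∑-translate {suc k} (true ∷ v)  g = trans (∑-vectors-suc k _)
  (trans (cong₂ _+_ (∑-translate v _) (∑-translate v _))
    (trans (+-comm (∑ (vectors k) (g ∘ (true ∷_))) _) (sym (∑-vectors-suc k g))))

nonzeros-support : ∀ k → All (λ x → ∃ λ i → lookup x i ≡ true) (nonzeros k)
nonzeros-support zero    = []
nonzeros-support (suc k) = All.++⁺
  (All.map⁺ (All.map (λ (i , e) → suc i , e) (nonzeros-support k)))
  (All.map⁺ (All.universal (λ _ → zero , refl) (vectors k)))

-- A multiplicative indicator: `n` times `u / n` raised to the truth value of `A`. With `1` and `0`
-- it is the ordinary indicator function.
pick : Dec A → ℕ → ℕ → ℕ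
pick (yes _) u n = u
pick (no _)  u n = n

pick-mono : ∀ {u n} (A? : Dec A) (B? : Dec B) → n ≤ u → (A → B) → pick A? u n ≤ pick B? u n
pick-mono (yes p) (yes q) n≤u f = ≤-refl
pick-mono (yes p) (no ¬q) n≤u f = contradiction (f p) ¬q
pick-mono (no ¬p) (yes q) n≤u f = n≤u
pick-mono (no ¬p) (no ¬q) n≤u f = ≤-refl

pick-≤ : ∀ {u n} (A? : Dec A) → n ≤ u → pick A? u n ≤ u
pick-≤ (yes _) n≤u = ≤-refl
pick-≤ (no _)  n≤u = n≤u

pick-no : ∀ {u n} (A? : Dec A) → ¬ A → pick A? u n ≡ n
pick-no (yes p) ¬p = contradiction p ¬p
pick-no (no _)  ¬p = refl

pick-^ : ∀ (A? : Dec A) u n K → pick A? u n ^ K ≡ pick A? (u ^ K) (n ^ K)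
pick-^ (yes _) u n K = refl
pick-^ (no _)  u n K = refl

∃? : ∀ {s} {P : Vec Bool s → Set} → (∀ c → Dec (P c)) → Dec (∃ P)
∃? {zero}  P? = map′ (λ p → [] , p) (λ { ([] , p) → p }) (P? [])
∃? {suc s} P? = map′
  [ (λ (c , p) → false ∷ c , p) , (λ (c , p) → true ∷ c , p) ]
  (λ { (false ∷ c , p) → inj₁ (c , p) ; (true ∷ c , p) → inj₂ (c , p) })
  (∃? (P? ∘ (false ∷_)) ⊎-dec ∃? (P? ∘ (true ∷_)))

∀? : ∀ {m} {P : Vec (Fin k) m → Set} → (∀ l → Dec (P l)) → Dec (∀ l → P l)
∀? {m = zero}  P? = map′ (λ { p [] → p }) (λ p → p []) (P? [])
∀? {m = suc m} P? = map′ (λ { p (i ∷ l) → p i l }) (λ p i l → p (i ∷ l))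
  (all? λ i → ∀? (P? ∘ (i ∷_)))

∑-zero : (xs : List A) → ∑ xs (λ _ → 0) ≡ 0
∑-zero xs = trans (∑-const xs 0) (*-zeroʳ (length xs))

-- Linear functionals, subspaces and rank

record Functional (s : ℕ) : Set where
  field
    _·_      : Vec Bool s → Bool
    additive : ∀ c c′ → _·_ (c ⊕ c′) ≡ (_·_ c) xor (_·_ c′)

open Functional

-- Possibly empty: only closure under addition is needed.
record Subspace (s : ℕ) : Set₁ where
  field
    _∋_    : Vec Bool s → Set
    _∋?_   : ∀ c → Dec (_∋_ c)
    closed : ∀ {c c′} → _∋_ c → _∋_ c′ → _∋_ (c ⊕ c′)

open Subspace

card : Subspace s → ℕ
card {s} S = ∑ (vectors s) (λ c → pick (S ∋? c) 1 0)

kill : Subspace s → Functional s → Subspace s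
kill S f = record
  { _∋_    = λ c → S ∋ c × f · c ≡ false
  ; _∋?_   = λ c → (S ∋? c) ×-dec (f · c ≟ false)
  ; closed = λ (p , e) (q , e′) → closed S p q , trans (additive f _ _) (cong₂ _xor_ e e′)
  }

kills : Subspace s → List (Functional s) → Subspace s
kills S []       = S
kills S (f ∷ fs) = kills (kill S f) fs

Onto : Subspace s → Functional s → Set
Onto S f = ∃ λ c → S ∋ c × f · c ≡ true

onto? : (S : Subspace s) (f : Functional s) → Dec (Onto S f)
onto? S f = ∃? λ c → (S ∋? c) ×-dec (f · c ≟ true)

-- (u / n) to the dimension of the image of S under (f₁, …, f_N), multiplied by n ^ N.
weight : ℕ → ℕ → Subspace s → List (Functional s) → ℕ
weight u n S []       = 1
weight u n S (f ∷ fs) = pick (onto? S f) u n * weight u n (kill S f) fs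

weight-++ : ∀ u n (S : Subspace s) fs gs →
  weight u n S (fs ++ gs) ≡ weight u n S fs * weight u n (kills S fs) gs
weight-++ u n S []       gs = sym (+-identityʳ _)
weight-++ u n S (f ∷ fs) gs =
  trans (cong (pick (onto? S f) u n *_) (weight-++ u n (kill S f) fs gs))
    (sym (*-assoc (pick (onto? S f) u n) _ _))

weight-^ : ∀ u n (S : Subspace s) fs K → weight u n S fs ^ K ≡ weight (u ^ K) (n ^ K) S fs
weight-^ u n S []       K = ^-zeroˡ K
weight-^ u n S (f ∷ fs) K = trans (^-distribʳ-* (pick (onto? S f) u n) _ K)
  (cong₂ _*_ (pick-^ (onto? S f) u n K) (weight-^ u n (kill S f) fs K))

-- Makes `weight n u` the denominator-clearing partner `Ḡ` of `weight u n` in `hölder`.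
weight-swap : ∀ u n (S : Subspace s) fs →
  weight u n S fs * weight n u S fs ≡ (u * n) ^ length fs
weight-swap u n S []       = refl
weight-swap u n S (f ∷ fs) = trans
  (*-interchange (pick (onto? S f) u n) _ (pick (onto? S f) n u) _)
  (cong₂ _*_ (pick-swap (onto? S f)) (weight-swap u n (kill S f) fs))
  where
  pick-swap : (A? : Dec A) → pick A? u n * pick A? n u ≡ u * n
  pick-swap (yes _) = refl
  pick-swap (no _)  = *-comm n u

-- The dimension of the image of `S`, by the chain rule: `f` counts when it does not vanish on the
-- part of `S` killed by all earlier functionals. It is the exponent of `u` in `weight`, and
-- `corank` that of `n`.
rank : Subspace s → List (Functional s) → ℕ
rank S []       = 0
rank S (f ∷ fs) = pick (onto? S f) 1 0 + rank (kill S f) fs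

corank : Subspace s → List (Functional s) → ℕ
corank S []       = 0
corank S (f ∷ fs) = pick (onto? S f) 0 1 + corank (kill S f) fs

rank+corank : (S : Subspace s) (fs : List (Functional s)) → rank S fs + corank S fs ≡ length fs
rank+corank S []       = refl
rank+corank S (f ∷ fs) with onto? S f
... | yes _ = cong suc (rank+corank (kill S f) fs)
... | no  _ = trans (+-suc (rank (kill S f) fs) _) (cong suc (rank+corank (kill S f) fs))

weight-rank : ∀ u n (S : Subspace s) fs → weight u n S fs ≡ u ^ rank S fs * n ^ corank S fs
weight-rank u n S []       = refl
weight-rank u n S (f ∷ fs) with onto? S f
... | yes _ = trans (cong (u *_) (weight-rank u n (kill S f) fs)) (sym (*-assoc u _ _))
... | no  _ = trans (cong (n *_) (weight-rank u n (kill S f) fs))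
  (x∙yz≈y∙xz n (u ^ rank (kill S f) fs) _)

module _ where
  open ≤-Reasoning

  -- If `f` is `true` at some `c₁` in `S`, translation by `c₁` carries the kernel of `f` in `S` to a
  -- disjoint subset of `S`, so `S` is at least twice as large as the kernel.
  2^rank≤card : (S : Subspace s) (fs : List (Functional s)) → ∃ (S ∋_) → 2 ^ rank S fs ≤ card S
  -- Translation by `c` moves the summand of `c` to the zero vector, the head of the enumeration.
  2^rank≤card {s} S [] (c , S∋c) = begin
    1                                       ≤⟨ 1≤ (S ∋? _) (subst (S ∋_) (sym (0⊕ c)) S∋c) ⟩
    pick (S ∋? (replicate s false ⊕ c)) 1 0 ≤⟨ ≤-trans (m≤m+n _ _) (≤-reflexive (sym (∑-vectors s _))) ⟩
    ∑ (vectors s) (λ x → pick (S ∋? (x ⊕ c)) 1 0) ≡⟨ ∑-translate c _ ⟩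
    card S ∎
    where
    1≤ : (A? : Dec A) → A → 1 ≤ pick A? 1 0
    1≤ (yes _) p = s≤s z≤n
    1≤ (no ¬p) p = contradiction p ¬p
  2^rank≤card {s} S (f ∷ fs) (c , S∋c) with onto? S f
  ... | yes (c₁ , S∋c₁ , fc₁) = begin
    2 * 2 ^ rank (kill S f) fs
      ≤⟨ *-monoʳ-≤ 2 (2^rank≤card (kill S f) fs
           (c₁ ⊕ c₁ , closed S S∋c₁ S∋c₁ , trans (additive f c₁ c₁) (xor-same (f · c₁)))) ⟩
    2 * card (kill S f)
      ≡⟨ cong (card (kill S f) +_) (+-identityʳ _) ⟩
    card (kill S f) + card (kill S f)
      ≡⟨ cong (card (kill S f) +_) (sym (∑-translate c₁ _)) ⟩
    card (kill S f) + ∑ (vectors s) (λ c → pick (kill S f ∋? (c ⊕ c₁)) 1 0)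
      ≡⟨ sym (∑-+ (vectors s) _ _) ⟩
    ∑ (vectors s) (λ c → pick (kill S f ∋? c) 1 0 + pick (kill S f ∋? (c ⊕ c₁)) 1 0)
      ≤⟨ ∑-mono (vectors s) (λ c → disjoint (kill S f ∋? c) (kill S f ∋? (c ⊕ c₁)) (S ∋? c)
           proj₁
           (λ (p , _) → subst (S ∋_) (⊕-cancelʳ c c₁) (closed S p S∋c₁))
           (λ (_ , e) (_ , e′) → contradiction
             (trans (sym (cong₂ _xor_ e fc₁)) (trans (sym (additive f c c₁)) e′)) λ ())) ⟩
    card S ∎
    where
    disjoint : ∀ {A B C : Set} (A? : Dec A) (B? : Dec B) (C? : Dec C) →
      (A → C) → (B → C) → (A → ¬ B) → pick A? 1 0 + pick B? 1 0 ≤ pick C? 1 0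
    disjoint (yes p) (yes q) _       f g h = contradiction q (h p)
    disjoint (yes p) (no _)  (yes _) f g h = s≤s z≤n
    disjoint (yes p) (no _)  (no ¬r) f g h = contradiction (f p) ¬r
    disjoint (no _)  (yes q) (yes _) f g h = s≤s z≤n
    disjoint (no _)  (yes q) (no ¬r) f g h = contradiction (g q) ¬r
    disjoint (no _)  (no _)  _       f g h = z≤n
  ... | no ¬onto = ≤-trans
    (2^rank≤card (kill S f) fs (c , S∋c , ¬-not (λ fc → ¬onto (c , S∋c , fc))))
    (∑-mono (vectors s) (λ c → pick-mono (kill S f ∋? c) (S ∋? c) z≤n proj₁))

  -- Counting the vectors in the image of a subspace

  Hits : Subspace s → (Fin k → Functional s) → Vec Bool k → Set
  Hits S f x = ∃ λ c → S ∋ c × (∀ i → f i · c ≡ lookup x i)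

  hits? : (S : Subspace s) (f : Fin k → Functional s) (x : Vec Bool k) → Dec (Hits S f x)
  hits? S f x = ∃? λ c → (S ∋? c) ×-dec all? (λ i → f i · c ≟ lookup x i)

  hits-kill : (S : Subspace s) (f : Fin (suc k) → Functional s) (x : Vec Bool k) →
    Hits S f (false ∷ x) → Hits (kill S (f zero)) (f ∘ suc) x
  hits-kill S f x (c , p , e) = c , (p , e zero) , e ∘ suc

  -- The `suc` counts the zero vector. Vectors with head `false` are hit from the kernel of
  -- `f zero`. If `f zero` is `true` at some `c₁`, adding the image of `c₁` maps those with head
  -- `true` injectively to vectors hit from the kernel, which gives the factor 2; otherwise there
  -- are none.
  nonzero-hits<2^rank : ∀ k (S : Subspace s) (f : Fin k → Functional s) →
    suc (∑ (nonzeros k) (λ x → pick (hits? S f x) 1 0)) ≤ 2 ^ rank S (tabulate f)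
  nonzero-hits<2^rank zero S f = ≤-refl
  nonzero-hits<2^rank (suc k) S f = begin
    suc (∑ (nonzeros (suc k)) (λ x → pick (hits? S f x) 1 0))
      ≡⟨ cong suc (∑-nonzeros-suc k _) ⟩
    suc (∑ (nonzeros k) (λ x → pick (hits? S f (false ∷ x)) 1 0)
       + ∑ (vectors k) (λ x → pick (hits? S f (true ∷ x)) 1 0))
      ≤⟨ s≤s (+-mono-≤ (∑-mono (nonzeros k) λ x → pick-mono (hits? S f (false ∷ x)) (hits? S′ f′ x)
           z≤n (hits-kill S f x)) ≤-refl) ⟩
    suc (∑ (nonzeros k) (λ x → pick (hits? S′ f′ x) 1 0)
       + ∑ (vectors k) (λ x → pick (hits? S f (true ∷ x)) 1 0))
      ≤⟨ rest ⟩
    2 ^ rank S (tabulate f) ∎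
    where
    S′ = kill S (f zero)
    f′ = f ∘ suc
    rest : suc (∑ (nonzeros k) (λ x → pick (hits? S′ f′ x) 1 0)
        + ∑ (vectors k) (λ x → pick (hits? S f (true ∷ x)) 1 0))
      ≤ 2 ^ rank S (tabulate f)
    rest with onto? S (f zero)
    ... | yes (c₁ , S∋c₁ , fc₁) = begin
      suc (∑ (nonzeros k) (λ x → pick (hits? S′ f′ x) 1 0))
         + ∑ (vectors k) (λ x → pick (hits? S f (true ∷ x)) 1 0)
        ≤⟨ +-mono-≤ (nonzero-hits<2^rank k S′ f′) (begin
          ∑ (vectors k) (λ x → pick (hits? S f (true ∷ x)) 1 0)
            ≤⟨ ∑-mono (vectors k) (λ x → pick-mono (hits? S f (true ∷ x)) (hits? S′ f′ (x ⊕ v))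
                 z≤n (shift x)) ⟩
          ∑ (vectors k) (λ x → pick (hits? S′ f′ (x ⊕ v)) 1 0)
            ≡⟨ ∑-translate v (λ x → pick (hits? S′ f′ x) 1 0) ⟩
          ∑ (vectors k) (λ x → pick (hits? S′ f′ x) 1 0)
            ≡⟨ ∑-vectors k (λ x → pick (hits? S′ f′ x) 1 0) ⟩
          pick (hits? S′ f′ (replicate k false)) 1 0 + ∑ (nonzeros k) (λ x → pick (hits? S′ f′ x) 1 0)
            ≤⟨ +-monoˡ-≤ _ (pick-≤ (hits? S′ f′ (replicate k false)) z≤n) ⟩
          suc (∑ (nonzeros k) (λ x → pick (hits? S′ f′ x) 1 0))
            ≤⟨ nonzero-hits<2^rank k S′ f′ ⟩
          2 ^ rank S′ (tabulate f′)
            ≡⟨ sym (+-identityʳ _) ⟩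
          2 ^ rank S′ (tabulate f′) + 0 ∎) ⟩
      2 * 2 ^ rank S′ (tabulate f′) ∎
      where
      v = Vec.tabulate (λ i → f′ i · c₁)
      shift : ∀ x → Hits S f (true ∷ x) → Hits S′ f′ (x ⊕ v)
      shift x (c , p , e) = c ⊕ c₁
        , (closed S p S∋c₁ , trans (additive (f zero) c c₁) (cong₂ _xor_ (e zero) fc₁))
        , λ i → trans (additive (f′ i) c c₁)
            (trans (cong₂ _xor_ (e (suc i)) (sym (lookup∘tabulate (λ i → f′ i · c₁) i)))
              (sym (lookup-zipWith _xor_ i x v)))
    ... | no ¬onto = begin
      suc (∑ (nonzeros k) (λ x → pick (hits? S′ f′ x) 1 0)
         + ∑ (vectors k) (λ x → pick (hits? S f (true ∷ x)) 1 0))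
        ≡⟨ cong suc (cong (∑ (nonzeros k) (λ x → pick (hits? S′ f′ x) 1 0) +_)
             (trans (∑-cong (vectors k) λ x → pick-no (hits? S f (true ∷ x))
               (λ (c , p , e) → ¬onto (c , p , e zero))) (∑-zero (vectors k)))) ⟩
      suc (∑ (nonzeros k) (λ x → pick (hits? S′ f′ x) 1 0) + 0)
        ≡⟨ cong suc (+-identityʳ _) ⟩
      suc (∑ (nonzeros k) (λ x → pick (hits? S′ f′ x) 1 0))
        ≤⟨ nonzero-hits<2^rank k S′ f′ ⟩
      2 ^ rank S′ (tabulate f′) ∎

  -- The order-one case. The sum grows with the number `h` of hits, which falls short of `2 ^ r - 1`
  -- by `g`; treating `g` further vectors as hit reduces the claim to `layer-ineq` at `d = r`.
  layer-bound : ∀ (S : Subspace s) (f : Fin k → Functional s) V w → w ≤ V →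
    ∑ (nonzeros k) (λ x → pick (hits? S f x) ((V + w) ^ k) (V ^ k))
      ≤ length (nonzeros k) * weight (V + w) V S (tabulate f)
  layer-bound {k = k} S f V w w≤V =
    subst (λ W → Σₓ ≤ L * W) (sym (weight-rank U V S (tabulate f)))
      (+-cancelˡ-≤ G _ _ (+-cancelʳ-≤ (2 ^ r * Vᵏ + Uᵏ) _ _ (begin
        G + Σₓ + (2 ^ r * Vᵏ + Uᵏ)
          ≡⟨ cong (λ z → G + z + (2 ^ r * Vᵏ + Uᵏ)) Σₓ≡ ⟩
        G + (h * Uᵏ + h′ * Vᵏ) + (2 ^ r * Vᵏ + Uᵏ)
          ≡⟨ cong (λ z → G + (h * Uᵏ + h′ * Vᵏ) + (z * Vᵏ + Uᵏ)) (sym 1+h+g≡2^r) ⟩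
        G + (h * Uᵏ + h′ * Vᵏ) + ((suc h + g) * Vᵏ + Uᵏ)
          ≡⟨ e₁ G h h′ g Uᵏ Vᵏ ⟩
        G + suc h * Uᵏ + g * Vᵏ + suc (h + h′) * Vᵏ
          ≤⟨ +-monoˡ-≤ _ (+-monoʳ-≤ (G + suc h * Uᵏ) (*-monoʳ-≤ g (^-monoˡ-≤ k (m≤m+n V w)))) ⟩
        G + suc h * Uᵏ + g * Uᵏ + suc (h + h′) * Vᵏ
          ≡⟨ e₂ G h g Uᵏ (suc (h + h′) * Vᵏ) ⟩
        (suc h + g) * Uᵏ + suc (h + h′) * Vᵏ + G
          ≡⟨ cong₂ (λ y z → y * Uᵏ + z * Vᵏ + G) 1+h+g≡2^r (trans (cong suc h+h′≡L) (length-nonzeros k)) ⟩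
        2 ^ r * Uᵏ + 2 ^ k * Vᵏ + G
          ≤⟨ subst (λ n → 2 ^ r * U ^ n + 2 ^ n * V ^ n + G ≤ 2 ^ n * G + 2 ^ r * V ^ n + U ^ n)
               (trans (rank+corank S (tabulate f)) (length-tabulate f)) (layer-ineq r j V w w≤V) ⟩
        2 ^ k * G + 2 ^ r * Vᵏ + Uᵏ
          ≡⟨ cong (λ z → z * G + 2 ^ r * Vᵏ + Uᵏ) (sym (length-nonzeros k)) ⟩
        suc L * G + 2 ^ r * Vᵏ + Uᵏ
          ≡⟨ +-assoc (suc L * G) _ _ ⟩
        G + L * G + (2 ^ r * Vᵏ + Uᵏ) ∎)))
    where
    U = V + w
    Uᵏ = U ^ k
    Vᵏ = V ^ k
    L = length (nonzeros k)
    r = rank S (tabulate f)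
    j = corank S (tabulate f)
    G = U ^ r * V ^ j
    Σₓ = ∑ (nonzeros k) (λ x → pick (hits? S f x) Uᵏ Vᵏ)
    h = ∑ (nonzeros k) (λ x → pick (hits? S f x) 1 0)
    h′ = ∑ (nonzeros k) (λ x → pick (hits? S f x) 0 1)
    g = proj₁ (m≤n⇒∃[o]m+o≡n (nonzero-hits<2^rank k S f))
    1+h+g≡2^r : suc h + g ≡ 2 ^ r
    1+h+g≡2^r = proj₂ (m≤n⇒∃[o]m+o≡n (nonzero-hits<2^rank k S f))
    pick-split : ∀ {P : Set} (P? : Dec P) a b → pick P? a b ≡ a * pick P? 1 0 + b * pick P? 0 1
    pick-split (yes _) a b = sym (trans (cong₂ _+_ (*-identityʳ a) (*-zeroʳ b)) (+-identityʳ a))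
    pick-split (no _)  a b = sym (cong₂ _+_ (*-zeroʳ a) (*-identityʳ b))
    Σₓ≡ : Σₓ ≡ h * Uᵏ + h′ * Vᵏ
    Σₓ≡ = trans (∑-cong (nonzeros k) (λ x → pick-split (hits? S f x) Uᵏ Vᵏ))
      (trans (∑-+ (nonzeros k) _ _)
        (cong₂ _+_ (trans (∑-*ˡ Uᵏ (nonzeros k) _) (*-comm Uᵏ h))
                   (trans (∑-*ˡ Vᵏ (nonzeros k) _) (*-comm Vᵏ h′))))
    h+h′≡L : h + h′ ≡ L
    h+h′≡L = trans (sym (∑-+ (nonzeros k) _ _))
      (trans (∑-cong (nonzeros k) (λ x → pick-sum (hits? S f x)))
        (trans (∑-const (nonzeros k) 1) (*-identityʳ L)))
      where
      pick-sum : ∀ {P : Set} (P? : Dec P) → pick P? 1 0 + pick P? 0 1 ≡ 1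
      pick-sum (yes _) = refl
      pick-sum (no _)  = refl
    e₁ : ∀ G h h′ g Uᵏ Vᵏ → G + (h * Uᵏ + h′ * Vᵏ) + ((suc h + g) * Vᵏ + Uᵏ)
      ≡ G + suc h * Uᵏ + g * Vᵏ + suc (h + h′) * Vᵏ
    e₁ = solve-∀
    e₂ : ∀ G h g Uᵏ x → G + suc h * Uᵏ + g * Uᵏ + x ≡ (suc h + g) * Uᵏ + x + G
    e₂ = solve-∀

-- Pure tensors in a subspace

vecs : {A : Set a} (n : ℕ) → List A → List (Vec A n)
vecs zero    xs = [] ∷ []
vecs (suc n) xs = concatMap (λ x → map (x ∷_) (vecs n xs)) xs

∑-vecs-suc : ∀ n (xs : List A) (g : Vec A (suc n) → ℕ) →
  ∑ (vecs (suc n) xs) g ≡ ∑ xs (λ x → ∑ (vecs n xs) (λ v → g (x ∷ v)))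
∑-vecs-suc n xs g = trans (∑-concatMap _ xs g) (∑-cong xs λ x → ∑-map (x ∷_) (vecs n xs) g)

length-vecs : ∀ n (xs : List A) → length (vecs n xs) ≡ length xs ^ n
length-vecs n xs = trans (sym (trans (∑-const (vecs n xs) 1) (*-identityʳ _))) (count n)
  where
  count : ∀ n → ∑ (vecs n xs) (λ _ → 1) ≡ length xs ^ n
  count zero    = refl
  count (suc n) = trans (∑-vecs-suc n xs (λ _ → 1))
    (trans (∑-cong xs (λ _ → count n)) (∑-const xs _))

⨂ : Vec (Vec Bool k) m → Vec (Fin k) m → Bool
⨂ []      []      = true
⨂ (x ∷ y) (i ∷ l) = lookup x i ∧ ⨂ y l

-- The first coordinate varies fastest: the blocks over which it runs are the layers to which
-- Hölder's inequality is applied.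
indices : ∀ k m → List (Vec (Fin k) m)
indices k zero    = [] ∷ []
indices k (suc m) = concatMap (λ l → tabulate (_∷ l)) (indices k m)

length-indices : ∀ k m → length (indices k m) ≡ k ^ m
length-indices k zero    = refl
length-indices k (suc m) = trans (go (indices k m)) (trans (*-comm _ k) (cong (k *_) (length-indices k m)))
  where
  go : ∀ ls → length (concatMap (λ l → tabulate {n = k} (_∷ l)) ls) ≡ length ls * k
  go []       = refl
  go (l ∷ ls) = trans (length-++ (tabulate {n = k} (_∷ l)))
    (cong₂ _+_ (length-tabulate {n = k} (_∷ l)) (go ls))

-- A space of tensors is represented as the image of a subspace of 𝔽₂^s under these functionals, one
-- per tensor entry. The map may have a kernel, so no basis is ever chosen.
Coordinates : ℕ → ℕ → ℕ → Set
Coordinates k m s = Vec (Fin k) m → Functional s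

block : Coordinates k (suc m) s → Vec (Fin k) m → Fin k → Functional s
block φ l i = φ (i ∷ l)

-- Each layer `l` is paired with the part of `S` that vanishes on all earlier layers. The dimension
-- of the whole image is then the sum of the dimensions of the images of these parts in their own
-- layers.
stages : Subspace s → Coordinates k (suc m) s → List (Vec (Fin k) m) →
  List (Subspace s × Vec (Fin k) m)
stages S φ []       = []
stages S φ (l ∷ ls) = (S , l) ∷ stages (kills S (tabulate (block φ l))) φ ls

length-stages : (S : Subspace s) (φ : Coordinates k (suc m) s) (ls : List (Vec (Fin k) m)) →
  length (stages S φ ls) ≡ length ls
length-stages S φ []       = refl
length-stages S φ (l ∷ ls) = cong suc (length-stages _ φ ls)

weight-stages : ∀ u n (S : Subspace s) (φ : Coordinates k (suc m) s) ls →
  weight u n S (map φ (concatMap (λ l → tabulate (_∷ l)) ls))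
    ≡ ∏ (stages S φ ls) (λ (S′ , l) → weight u n S′ (tabulate (block φ l)))
weight-stages u n S φ []       = refl
weight-stages u n S φ (l ∷ ls)
  rewrite map-++ φ (tabulate (_∷ l)) (concatMap (λ l → tabulate (_∷ l)) ls)
        | map-tabulate (_∷ l) φ
        | weight-++ u n S (tabulate (block φ l)) (map φ (concatMap (λ l → tabulate (_∷ l)) ls))
  = cong (weight u n S (tabulate (block φ l)) *_) (weight-stages u n _ φ ls)

∋-kills : (S : Subspace s) (f : Fin k → Functional s) {c : Vec Bool s} →
  S ∋ c → (∀ i → f i · c ≡ false) → kills S (tabulate f) ∋ c
∋-kills {k = zero}  S f p e = p
∋-kills {k = suc _} S f p e = ∋-kills (kill S (f zero)) (f ∘ suc) (p , e zero) (e ∘ suc)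

-- For `c` in `Q`, layer `l` is `x` times the scalar `ψ l · c`. If this scalar can be `true`, the
-- layer can equal `x`, so `x` hits the stage; where it is `false`, the whole layer vanishes, so
-- killing `ψ l` keeps `Q` inside the next stage.
weight-stages-≤ : ∀ {u n} (S Q : Subspace s) (φ : Coordinates k (suc m) s) (ψ : Coordinates k m s)
  (x : Vec Bool k) → n ≤ u →
  (∀ {c} → Q ∋ c → S ∋ c) →
  (∀ {c} → Q ∋ c → ∀ i l → φ (i ∷ l) · c ≡ lookup x i ∧ ψ l · c) → ∀ ls →
  weight u n Q (map ψ ls) ≤ ∏ (stages S φ ls) (λ (S′ , l) → pick (hits? S′ (block φ l) x) u n)
weight-stages-≤ S Q φ ψ x n≤u Q⊆S split []       = ≤-refl
weight-stages-≤ S Q φ ψ x n≤u Q⊆S split (l ∷ ls) = *-mono-≤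
  (pick-mono (onto? Q (ψ l)) (hits? S (block φ l) x) n≤u
    (λ (c , q , e) → c , Q⊆S q , λ i → trans (split q i l)
      (trans (cong (lookup x i ∧_) e) (∧-identityʳ _))))
  (weight-stages-≤ (kills S (tabulate (block φ l))) (kill Q (ψ l)) φ ψ x n≤u
    (λ (q , e) → ∋-kills S (block φ l) (Q⊆S q) λ i → trans (split q i l)
      (trans (cong (lookup x i ∧_) e) (∧-zeroʳ _)))
    (λ (q , e) → split q) ls)

Contains : Subspace s → Coordinates k m s → Vec (Vec Bool k) m → Set
Contains S φ y = ∃ λ c → S ∋ c × (∀ l → φ l · c ≡ ⨂ y l)

contains? : (S : Subspace s) (φ : Coordinates k m s) (y : Vec (Vec Bool k) m) → Dec (Contains S φ y)
contains? S φ y = ∃? λ c → (S ∋? c) ×-dec ∀? (λ l → φ l · c ≟ ⨂ y l)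

-- The tensors of S divisible by x, where i₀ is in the support of x; dividing by x amounts to
-- restricting the first index to i₀.
divisible : Subspace s → Coordinates k (suc m) s → Vec Bool k → Fin k → Subspace s
divisible S φ x i₀ = record
  { _∋_    = λ c → S ∋ c × (∀ i l → φ (i ∷ l) · c ≡ lookup x i ∧ φ (i₀ ∷ l) · c)
  ; _∋?_   = λ c → (S ∋? c) ×-dec all? (λ i → ∀? (λ l → φ (i ∷ l) · c ≟ lookup x i ∧ φ (i₀ ∷ l) · c))
  ; closed = λ {c} {c′} (p , e) (q , e′) → closed S p q , λ i l →
      trans (additive (φ (i ∷ l)) c c′)
        (trans (cong₂ _xor_ (e i l) (e′ i l))
          (trans (sym (∧-distribˡ-xor (lookup x i) _ _))
            (cong (lookup x i ∧_) (sym (additive (φ (i₀ ∷ l)) c c′)))))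
  }

contains-divisible : (S : Subspace s) (φ : Coordinates k (suc m) s) (x : Vec Bool k) (i₀ : Fin k) →
  lookup x i₀ ≡ true → ∀ y → Contains S φ (x ∷ y) → Contains (divisible S φ x i₀) (λ l → φ (i₀ ∷ l)) y
contains-divisible S φ x i₀ xi₀ y (c , p , e) =
  c , (p , λ i l → trans (e (i ∷ l)) (cong (lookup x i ∧_) (sym (e₀ l)))) , e₀
  where
  e₀ : ∀ l → φ (i₀ ∷ l) · c ≡ ⨂ y l
  e₀ l = trans (e (i₀ ∷ l)) (cong (_∧ ⨂ y l) xi₀)

module _ where
  open ≤-Reasoning

  -- The `K`-th power required by Hölder is absorbed into the base: `layer-bound` is used for
  -- `(u / n) ^ K`, which is at most 2 because its `k`-th power is at most `2 ^ k`.
  hits-bound : ∀ {u n} .{{_ : NonZero k}}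
    (φ : Coordinates k (suc m) s) (K : ℕ) →
    n ≤ u → u ^ (k * K) ≤ 2 ^ k * n ^ (k * K) → ∀ S′ (l : Vec (Fin k) m) →
    ∑ (nonzeros k) (λ x → pick (hits? S′ (block φ l) x) (u ^ k) (n ^ k) ^ K)
      ≤ length (nonzeros k) * weight u n S′ (tabulate (block φ l)) ^ K
  hits-bound {k} {u = u} {n} φ K n≤u bound S′ l = begin
    ∑ (nonzeros k) (λ x → pick (H? x) (u ^ k) (n ^ k) ^ K)
      ≡⟨ ∑-cong (nonzeros k) (λ x → trans (pick-^ (H? x) (u ^ k) (n ^ k) K)
           (cong₂ (pick (H? x)) (^-comm u k K) (^-comm n k K))) ⟩
    ∑ (nonzeros k) (λ x → pick (H? x) ((u ^ K) ^ k) ((n ^ K) ^ k))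
      ≡⟨ cong (λ z → ∑ (nonzeros k) (λ x → pick (H? x) (z ^ k) ((n ^ K) ^ k))) (sym n+w≡u) ⟩
    ∑ (nonzeros k) (λ x → pick (H? x) ((n ^ K + w) ^ k) ((n ^ K) ^ k))
      ≤⟨ layer-bound S′ (block φ l) (n ^ K) w (+-cancelˡ-≤ (n ^ K) _ _ (begin
           n ^ K + w           ≡⟨ n+w≡u ⟩
           u ^ K               ≤⟨ ^-cancelʳ-≤ k (begin
             (u ^ K) ^ k         ≡⟨ ^-comm u K k ⟩
             (u ^ k) ^ K         ≡⟨ ^-*-assoc u k K ⟩
             u ^ (k * K)         ≤⟨ bound ⟩
             2 ^ k * n ^ (k * K) ≡⟨ cong (2 ^ k *_) (trans (sym (^-*-assoc n k K)) (^-comm n k K)) ⟩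
             2 ^ k * (n ^ K) ^ k ≡⟨ sym (^-distribʳ-* 2 (n ^ K) k) ⟩
             (2 * n ^ K) ^ k ∎) ⟩
           2 * n ^ K           ≡⟨ cong (n ^ K +_) (+-identityʳ _) ⟩
           n ^ K + n ^ K ∎)) ⟩
    length (nonzeros k) * weight (n ^ K + w) (n ^ K) S′ (tabulate (block φ l))
      ≡⟨ cong (λ z → length (nonzeros k) * weight z (n ^ K) S′ (tabulate (block φ l))) n+w≡u ⟩
    length (nonzeros k) * weight (u ^ K) (n ^ K) S′ (tabulate (block φ l))
      ≡⟨ cong (length (nonzeros k) *_) (sym (weight-^ u n S′ (tabulate (block φ l)) K)) ⟩
    length (nonzeros k) * weight u n S′ (tabulate (block φ l)) ^ K ∎
    where
    H? = hits? S′ (block φ l)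
    w = proj₁ (m≤n⇒∃[o]m+o≡n (^-monoˡ-≤ K n≤u))
    n+w≡u : n ^ K + w ≡ u ^ K
    n+w≡u = proj₂ (m≤n⇒∃[o]m+o≡n (^-monoˡ-≤ K n≤u))

  -- m n ^ N accounts for the tensors with a zero factor, the weight for all others.
  containment-bound : ∀ m .{{_ : NonZero k}} (S : Subspace s) (φ : Coordinates k m s) (u n : ℕ)
    .{{_ : NonZero n}} → n ≤ u → u ^ k ^ m ≤ 2 ^ k * n ^ k ^ m →
    ∑ (vecs m (vectors k)) (λ y → pick (contains? S φ y) (u ^ k ^ m) (n ^ k ^ m))
      ≤ (2 ^ k) ^ m * (m * n ^ k ^ m + weight u n S (map φ (indices k m)))
  containment-bound zero S φ u n n≤u bound = begin
    pick (contains? S φ []) (u ^ 1) (n ^ 1) + 0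
      ≡⟨ +-identityʳ _ ⟩
    pick (contains? S φ []) (u ^ 1) (n ^ 1)
      -- The empty product is the scalar `true`, so containing it makes the single functional `φ []`
      -- onto.
      ≤⟨ pick-mono (contains? S φ []) (onto? S (φ [])) (^-monoˡ-≤ 1 n≤u)
           (λ (c , p , e) → c , p , e []) ⟩
    pick (onto? S (φ [])) (u ^ 1) (n ^ 1)
      ≡⟨ trans (cong₂ (pick (onto? S (φ []))) (*-identityʳ u) (*-identityʳ n))
           (sym (trans (*-identityˡ _) (*-identityʳ _))) ⟩
    1 * (pick (onto? S (φ [])) u n * 1) ∎
  containment-bound {k} (suc m) S φ u n n≤u bound = begin
    ∑ (vecs (suc m) (vectors k)) (λ y → pick (contains? S φ y) (u ^ N) (n ^ N))
      ≡⟨ trans (∑-vecs-suc m (vectors k) _) (∑-vectors k _) ⟩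
    inner (replicate k false) + ∑ (nonzeros k) inner
      ≤⟨ +-mono-≤ zero-bound nonzero-bound ⟩
    M * (2 ^ k * n ^ N) + M * (L * (m * n ^ N + W))
      ≡⟨ e₁ M (2 ^ k) L (n ^ N) (m * n ^ N + W) ⟩
    M * (2 ^ k * n ^ N + L * (m * n ^ N + W))
      ≤⟨ *-monoʳ-≤ M (+-monoʳ-≤ (2 ^ k * n ^ N) (*-monoˡ-≤ (m * n ^ N + W)
           (≤-trans (n≤1+n L) (≤-reflexive (length-nonzeros k))))) ⟩
    M * (2 ^ k * n ^ N + 2 ^ k * (m * n ^ N + W))
      ≡⟨ e₂ M (2 ^ k) (n ^ N) m W ⟩
    2 ^ k * M * (suc m * n ^ N + W) ∎
    where
    K = k ^ m
    N = k * K
    M = (2 ^ k) ^ m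
    L = length (nonzeros k)
    W = weight u n S (map φ (indices k (suc m)))
    inner : Vec Bool k → ℕ
    inner x = ∑ (vecs m (vectors k)) (λ y → pick (contains? S φ (x ∷ y)) (u ^ N) (n ^ N))
    e₁ : ∀ M T L p q → M * (T * p) + M * (L * q) ≡ M * (T * p + L * q)
    e₁ = solve-∀
    e₂ : ∀ M T p m W → M * (T * p + T * (m * p + W)) ≡ T * M * (suc m * p + W)
    e₂ = solve-∀

    zs = stages S φ (indices k m)
    length-zs : length zs ≡ K
    length-zs = trans (length-stages S φ (indices k m)) (length-indices k m)
    F : Vec Bool k → Subspace _ × Vec (Fin k) m → ℕ
    F x (S′ , l) = pick (hits? S′ (block φ l) x) (u ^ k) (n ^ k)

    instance
      length-zs≢0 : NonZero (length zs)
      length-zs≢0 = subst NonZero (sym length-zs) (m^n≢0 k m)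
      u≢0 : NonZero u
      u≢0 = >-nonZero (≤-trans (>-nonZero⁻¹ n) n≤u)
      un≢0 : NonZero ((u * n) ^ k)
      un≢0 = m^n≢0 (u * n) k {{m*n≢0 u n}}

    -- The zero factor is one of `2 ^ k` choices and each tensor has weight at most `2 ^ k * n ^ N`,
    -- so on average it adds one further `n ^ N`: `m` becomes `suc m`.
    zero-bound : inner (replicate k false) ≤ M * (2 ^ k * n ^ N)
    zero-bound = begin
      inner (replicate k false)
        ≤⟨ ∑-mono (vecs m (vectors k)) (λ y → pick-≤ (contains? S φ (replicate k false ∷ y)) (^-monoˡ-≤ N n≤u)) ⟩
      ∑ (vecs m (vectors k)) (λ _ → u ^ N)
        ≡⟨ trans (∑-const (vecs m (vectors k)) (u ^ N))
             (cong (_* u ^ N) (trans (length-vecs m (vectors k)) (cong (_^ m) (length-vectors k)))) ⟩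
      M * u ^ N
        ≤⟨ *-monoʳ-≤ M bound ⟩
      M * (2 ^ k * n ^ N) ∎

    inner-bound : ∀ x → (∃ λ i → lookup x i ≡ true) → inner x ≤ M * (m * n ^ N + ∏ zs (F x))
    inner-bound x (i₀ , xi₀) = begin
      inner x
        ≤⟨ ∑-mono (vecs m (vectors k)) (λ y → pick-mono (contains? S φ (x ∷ y)) (contains? Q ψ y)
             (^-monoˡ-≤ N n≤u) (contains-divisible S φ x i₀ xi₀ y)) ⟩
      ∑ (vecs m (vectors k)) (λ y → pick (contains? Q ψ y) (u ^ N) (n ^ N))
        ≡⟨ cong₂ (λ p q → ∑ (vecs m (vectors k)) (λ y → pick (contains? Q ψ y) p q))
             (sym (^-*-assoc u k K)) (sym (^-*-assoc n k K)) ⟩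
      ∑ (vecs m (vectors k)) (λ y → pick (contains? Q ψ y) ((u ^ k) ^ K) ((n ^ k) ^ K))
        -- One order less is compensated by the base `(u / n) ^ k`: its power `k ^ m` is the old
        -- `(u / n) ^ N`, so the hypothesis on the root carries over.
        ≤⟨ containment-bound m Q ψ (u ^ k) (n ^ k) {{m^n≢0 n k}} (^-monoˡ-≤ k n≤u)
             (subst₂ (λ p q → p ≤ 2 ^ k * q) (sym (^-*-assoc u k K)) (sym (^-*-assoc n k K)) bound) ⟩
      M * (m * (n ^ k) ^ K + weight (u ^ k) (n ^ k) Q (map ψ (indices k m)))
        ≤⟨ *-monoʳ-≤ M (+-mono-≤ (≤-reflexive (cong (m *_) (^-*-assoc n k K)))
             (weight-stages-≤ S Q φ ψ x (^-monoˡ-≤ k n≤u) proj₁ proj₂ (indices k m))) ⟩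
      M * (m * n ^ N + ∏ zs (F x)) ∎
      where
      Q = divisible S φ x i₀
      ψ = λ l → φ (i₀ ∷ l)

    nonzero-bound : ∑ (nonzeros k) inner ≤ M * (L * (m * n ^ N + W))
    nonzero-bound = begin
      ∑ (nonzeros k) inner
        ≤⟨ ∑-mono-All (All.map (λ {x} → inner-bound x) (nonzeros-support k)) ⟩
      ∑ (nonzeros k) (λ x → M * (m * n ^ N + ∏ zs (F x)))
        ≡⟨ trans (∑-*ˡ M (nonzeros k) _) (cong (M *_) (trans (∑-+ (nonzeros k) _ _)
             (cong (_+ ∑ (nonzeros k) (λ x → ∏ zs (F x))) (∑-const (nonzeros k) _)))) ⟩
      M * (L * (m * n ^ N) + ∑ (nonzeros k) (λ x → ∏ zs (F x)))
        ≤⟨ *-monoʳ-≤ M (+-monoʳ-≤ (L * (m * n ^ N)) (hölder zs (nonzeros k) (λ z x → F x z)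
             (λ (S′ , l) → weight u n S′ (tabulate (block φ l)))
             (λ (S′ , l) → weight n u S′ (tabulate (block φ l))) ((u * n) ^ k) L
             (All.universal (λ (S′ , l) → trans (weight-swap u n S′ (tabulate (block φ l)))
               (cong ((u * n) ^_) (length-tabulate (block φ l)))) zs)
             (All.universal (λ (S′ , l) → hits-bound φ (length zs) n≤u
               (subst (λ K → u ^ (k * K) ≤ 2 ^ k * n ^ (k * K)) (sym length-zs) bound) S′ l) zs))) ⟩
      M * (L * (m * n ^ N) + L * ∏ zs (λ (S′ , l) → weight u n S′ (tabulate (block φ l))))
        ≡⟨ cong (M *_) (sym (*-distribˡ-+ L (m * n ^ N) _)) ⟩
      M * (L * (m * n ^ N + ∏ zs (λ (S′ , l) → weight u n S′ (tabulate (block φ l)))))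
        ≡⟨ cong (λ z → M * (L * (m * n ^ N + z))) (sym (weight-stages u n S φ (indices k m))) ⟩
      M * (L * (m * n ^ N + W)) ∎

-- Linear relations between random pure tensors

combination : Vec (Vec (Vec Bool k) m) t → Vec Bool t → Vec (Fin k) m → Bool
combination []       []      l = false
combination (y ∷ ys) (c ∷ d) l = (c ∧ ⨂ y l) xor combination ys d l

combination-⊕ : (ys : Vec (Vec (Vec Bool k) m) t) (c d : Vec Bool t) → ∀ l →
  combination ys (c ⊕ d) l ≡ combination ys c l xor combination ys d l
combination-⊕ []       []      []      l = refl
combination-⊕ (y ∷ ys) (a ∷ c) (b ∷ d) l = trans
  (cong₂ _xor_ (∧-distribʳ-xor (⨂ y l) a b) (combination-⊕ ys c d l))
  (xor-interchange (a ∧ ⨂ y l) (b ∧ ⨂ y l) _ _)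
  where
  xor-interchange : ∀ a b c d → (a xor b) xor (c xor d) ≡ (a xor c) xor (b xor d)
  xor-interchange false false c d = refl
  xor-interchange false true  c d = not-distribʳ-xor c d
  xor-interchange true  false c d = not-distribˡ-xor c d
  xor-interchange true  true  c d = sym (xor-annihilates-not c d)

span : Vec (Vec (Vec Bool k) m) t → Coordinates k m t
span ys l = record { _·_ = λ c → combination ys c l ; additive = λ c d → combination-⊕ ys c d l }

full : Subspace t
full = record { _∋_ = λ _ → ⊤ ; _∋?_ = λ _ → yes tt ; closed = λ _ _ → tt }

rank-full≤ : (fs : List (Functional t)) → rank full fs ≤ t
rank-full≤ {t} fs = ≮⇒≥ λ t<r → <⇒≱ (^-monoʳ-< 2 (s≤s (s≤s z≤n)) t<r)
  (≤-trans (2^rank≤card full fs (replicate t false , tt))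
    (≤-reflexive (trans (∑-const (vectors t) 1) (trans (*-identityʳ _) (length-vectors t)))))

-- The exponent of `u / n` in the weight is a rank, hence at most `t`; the gap `g` up to `T` is
-- filled using `n ≤ u`.
weight-full≤ : ∀ {u n T} (fs : List (Functional t)) → n ≤ u → t ≤ T →
  weight u n full fs * n ^ T ≤ u ^ T * n ^ length fs
weight-full≤ {u = u} {n} {T} fs n≤u t≤T = begin
  weight u n full fs * n ^ T
    ≡⟨ cong₂ _*_ (weight-rank u n full fs) (trans (cong (n ^_) (sym r+g≡T)) (^-distribˡ-+-* n r g)) ⟩
  u ^ r * n ^ j * (n ^ r * n ^ g)
    ≤⟨ *-monoʳ-≤ (u ^ r * n ^ j) (*-monoʳ-≤ (n ^ r) (^-monoˡ-≤ g n≤u)) ⟩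
  u ^ r * n ^ j * (n ^ r * u ^ g)
    ≡⟨ e (u ^ r) (n ^ j) (n ^ r) (u ^ g) ⟩
  u ^ r * u ^ g * (n ^ r * n ^ j)
    ≡⟨ cong₂ _*_ (trans (sym (^-distribˡ-+-* u r g)) (cong (u ^_) r+g≡T))
         (trans (sym (^-distribˡ-+-* n r j)) (cong (n ^_) (rank+corank full fs))) ⟩
  u ^ T * n ^ length fs ∎
  where
  open ≤-Reasoning
  r = rank full fs
  j = corank full fs
  r≤T = ≤-trans (rank-full≤ fs) t≤T
  g = proj₁ (m≤n⇒∃[o]m+o≡n r≤T)
  r+g≡T : r + g ≡ T
  r+g≡T = proj₂ (m≤n⇒∃[o]m+o≡n r≤T)
  e : ∀ a b c d → a * b * (c * d) ≡ a * d * (c * b)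
  e = solve-∀

-- Counting the first factors when the others are fixed

column : Fin k → Vec (Vec Bool k) t → Vec Bool t
column i = Vec.map (λ x → lookup x i)

column-⊕ : (i : Fin k) (xs xs′ : Vec (Vec Bool k) t) →
  column i (zipWith _⊕_ xs xs′) ≡ column i xs ⊕ column i xs′
column-⊕ i []       []         = refl
column-⊕ i (x ∷ xs) (x′ ∷ xs′) = cong₂ _∷_ (lookup-zipWith _xor_ i x x′) (column-⊕ i xs xs′)

∑-translate-vecs : (xs₀ : Vec (Vec Bool k) t) (g : Vec (Vec Bool k) t → ℕ) →
  ∑ (vecs t (vectors k)) (λ xs → g (zipWith _⊕_ xs xs₀)) ≡ ∑ (vecs t (vectors k)) g
∑-translate-vecs                []         g = refl
∑-translate-vecs {k} {suc t} (x₀ ∷ xs₀) g = trans (∑-vecs-suc t (vectors k) _)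
  (trans (∑-cong (vectors k) λ x → ∑-translate-vecs xs₀ (λ xs → g ((x ⊕ x₀) ∷ xs)))
    (trans (∑-translate x₀ (λ x → ∑ (vecs t (vectors k)) (λ xs → g (x ∷ xs))))
      (sym (∑-vecs-suc t (vectors k) g))))

-- ∑ₛ xₛ ⊗ yₛ = 0
Relation : Vec (Vec Bool k) t → Vec (Vec (Vec Bool k) m) t → Set
Relation xs ys = ∀ i l → combination ys (column i xs) l ≡ false

relation? : (xs : Vec (Vec Bool k) t) (ys : Vec (Vec (Vec Bool k) m) t) → Dec (Relation xs ys)
relation? xs ys = all? λ i → ∀? λ l → combination ys (column i xs) l ≟ false

relations : Vec (Vec (Vec Bool k) m) t → ℕ
relations {k} {t = t} ys = ∑ (vecs t (vectors k)) (λ xs → pick (relation? xs ys) 1 0)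

xor≡false⇒≡ : ∀ a {b} → a xor b ≡ false → b ≡ a
xor≡false⇒≡ false         e = e
xor≡false⇒≡ true  {true}  e = refl

relation-translate : ∀ {x y} {xs xs₀ : Vec (Vec Bool k) t} {ys : Vec (Vec (Vec Bool k) m) t} →
  Relation (x ∷ xs) (y ∷ ys) → Relation (x ∷ xs₀) (y ∷ ys) → Relation (zipWith _⊕_ xs xs₀) ys
relation-translate {x = x} {y} {xs} {xs₀} {ys} R R₀ i l = begin
  combination ys (column i (zipWith _⊕_ xs xs₀)) l
    ≡⟨ cong (λ c → combination ys c l) (column-⊕ i xs xs₀) ⟩
  combination ys (column i xs ⊕ column i xs₀) l
    ≡⟨ combination-⊕ ys (column i xs) (column i xs₀) l ⟩
  combination ys (column i xs) l xor combination ys (column i xs₀) l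
    ≡⟨ cong₂ _xor_ (xor≡false⇒≡ (lookup x i ∧ ⨂ y l) (R i l)) (xor≡false⇒≡ (lookup x i ∧ ⨂ y l) (R₀ i l)) ⟩
  (lookup x i ∧ ⨂ y l) xor (lookup x i ∧ ⨂ y l)
    ≡⟨ xor-same (lookup x i ∧ ⨂ y l) ⟩
  false ∎
  where open ≡-Reasoning

module _ where
  open ≤-Reasoning

  ∑-witness : {P : A → Set} (P? : ∀ x → Dec (P x)) (xs : List A) →
    ∃ P ⊎ ∑ xs (λ x → pick (P? x) 1 0) ≡ 0
  ∑-witness P? []       = inj₂ refl
  ∑-witness P? (x ∷ xs) with P? x
  ... | yes p = inj₁ (x , p)
  ... | no  _ = ∑-witness P? xs

  -- Two solutions with the same `x` differ by a relation among `ys` alone, so the solutions, if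
  -- there are any, translate into `Relation _ ys`.
  relations-fixed : ∀ x y (ys : Vec (Vec (Vec Bool k) m) t) →
    ∑ (vecs t (vectors k)) (λ xs → pick (relation? (x ∷ xs) (y ∷ ys)) 1 0) ≤ relations ys
  relations-fixed {k} {t = t} x y ys
    with ∑-witness (λ xs → relation? (x ∷ xs) (y ∷ ys)) (vecs t (vectors k))
  ... | inj₂ e = ≤-trans (≤-reflexive e) z≤n
  ... | inj₁ (xs₀ , R₀) = begin
    ∑ (vecs t (vectors k)) (λ xs → pick (relation? (x ∷ xs) (y ∷ ys)) 1 0)
      ≤⟨ ∑-mono (vecs t (vectors k)) (λ xs → pick-mono (relation? (x ∷ xs) (y ∷ ys))
           (relation? (zipWith _⊕_ xs xs₀) ys) z≤n
           (λ R → relation-translate {x = x} {y} {xs} {xs₀} {ys} R R₀)) ⟩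
    ∑ (vecs t (vectors k)) (λ xs → pick (relation? (zipWith _⊕_ xs xs₀) ys) 1 0)
      ≡⟨ ∑-translate-vecs xs₀ (λ xs → pick (relation? xs ys) 1 0) ⟩
    relations ys ∎

  relations-∷ : ∀ y (ys : Vec (Vec (Vec Bool k) m) t) →
    relations (y ∷ ys) ≤ pick (contains? full (span ys) y) (2 ^ k) 1 * relations ys
  relations-∷ {k} {t = t} y ys with contains? full (span ys) y
  ... | yes _ = begin
    relations (y ∷ ys)
      ≡⟨ ∑-vecs-suc t (vectors k) _ ⟩
    ∑ (vectors k) (λ x → ∑ (vecs t (vectors k)) (λ xs → pick (relation? (x ∷ xs) (y ∷ ys)) 1 0))
      ≤⟨ ∑-mono (vectors k) (λ x → relations-fixed x y ys) ⟩
    ∑ (vectors k) (λ _ → relations ys)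
      ≡⟨ trans (∑-const (vectors k) _) (cong (_* relations ys) (length-vectors k)) ⟩
    2 ^ k * relations ys ∎
  ... | no ¬contains = begin
    relations (y ∷ ys)
      ≡⟨ trans (∑-vecs-suc t (vectors k) _) (∑-vectors k _) ⟩
    inner (replicate k false) + ∑ (nonzeros k) inner
      ≤⟨ +-mono-≤ (relations-fixed (replicate k false) y ys)
           (∑-mono-All (All.map (λ {x} → vanish x) (nonzeros-support k))) ⟩
    relations ys + ∑ (nonzeros k) (λ _ → 0)
      ≡⟨ cong (relations ys +_) (∑-zero (nonzeros k)) ⟩
    1 * relations ys ∎
    where
    inner : Vec Bool k → ℕ
    inner x = ∑ (vecs t (vectors k)) (λ xs → pick (relation? (x ∷ xs) (y ∷ ys)) 1 0)
    vanish : ∀ x → (∃ λ i → lookup x i ≡ true) → inner x ≤ 0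
    vanish x (i , xi) = ≤-reflexive (trans
      (∑-cong (vecs t (vectors k)) (λ xs → pick-no (relation? (x ∷ xs) (y ∷ ys))
        (λ R → ¬contains (column i xs , tt , λ l → trans
          (xor≡false⇒≡ (lookup x i ∧ ⨂ y l) (R i l)) (cong (_∧ ⨂ y l) xi)))))
      (∑-zero (vecs t (vectors k))))

  total : ℕ → ℕ → ℕ → ℕ
  total t m k = ∑ (vecs t (vecs m (vectors k))) relations

  -- The `y`'s are added one at a time, each new one being tested against the span of the others.
  -- `T` stays fixed while `t` decreases, so every step contributes the same factor.
  total-bound : ∀ m .{{_ : NonZero k}} {u n T} .{{_ : NonZero n}} → n ≤ u →
    u ^ k ^ m ≤ 2 ^ k * n ^ k ^ m → 3 * (2 ^ k * n ^ k ^ m) ≤ 4 * u ^ k ^ m → t ≤ T →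
    (3 * n ^ T) ^ t * total t m k ≤ ((2 ^ k) ^ m * (4 * (m * n ^ T + u ^ T))) ^ t
  total-bound {k} {zero} m n≤u lower upper t≤T = ≤-trans
    (≤-reflexive (trans (+-identityʳ _) (trans (+-identityʳ _) (+-identityʳ _))))
    (pick-≤ (relation? {k} {m = m} [] []) z≤n)
  total-bound {k} {suc t} m {u} {n} {T} n≤u lower upper t<T = begin
    c * c ^ t * total (suc t) m k
      ≤⟨ *-monoʳ-≤ (c * c ^ t) split ⟩
    c * c ^ t * ∑ Ys (λ ys → relations ys * step ys)
      ≡⟨ e₁ c (c ^ t) _ ⟩
    c ^ t * (c * ∑ Ys (λ ys → relations ys * step ys))
      ≡⟨ cong (c ^ t *_) (sym (∑-*ˡ c Ys _)) ⟩
    c ^ t * ∑ Ys (λ ys → c * (relations ys * step ys))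
      ≤⟨ *-monoʳ-≤ (c ^ t) (∑-mono Ys λ ys → begin
           c * (relations ys * step ys) ≡⟨ x∙yz≈y∙xz c (relations ys) (step ys) ⟩
           relations ys * (c * step ys) ≤⟨ *-monoʳ-≤ (relations ys) (step-bound ys) ⟩
           relations ys * C             ≡⟨ *-comm (relations ys) C ⟩
           C * relations ys ∎) ⟩
    c ^ t * ∑ Ys (λ ys → C * relations ys)
      ≡⟨ trans (cong (c ^ t *_) (∑-*ˡ C Ys relations)) (x∙yz≈y∙xz (c ^ t) C _) ⟩
    C * (c ^ t * total t m k)
      ≤⟨ *-monoʳ-≤ C (total-bound m n≤u lower upper (<⇒≤ t<T)) ⟩
    C * C ^ t ∎
    where
    N = k ^ m
    M = (2 ^ k) ^ m
    c = 3 * n ^ T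
    C = M * (4 * (m * n ^ T + u ^ T))
    Ts = vecs m (vectors k)
    Ys = vecs t Ts
    e₁ : ∀ a b x → a * b * x ≡ b * (a * x)
    e₁ = solve-∀
    step : Vec (Vec (Vec Bool k) m) t → ℕ
    step ys = ∑ Ts (λ y → pick (contains? full (span ys) y) (2 ^ k) 1)
    split : total (suc t) m k ≤ ∑ Ys (λ ys → relations ys * step ys)
    split = begin
      total (suc t) m k
        ≡⟨ trans (∑-vecs-suc t Ts relations) (∑-swap Ts Ys _) ⟩
      ∑ Ys (λ ys → ∑ Ts (λ y → relations (y ∷ ys)))
        ≤⟨ ∑-mono Ys (λ ys → ∑-mono Ts (λ y → ≤-trans (relations-∷ y ys)
             (≤-reflexive (*-comm (pick (contains? full (span ys) y) (2 ^ k) 1) (relations ys))))) ⟩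
      ∑ Ys (λ ys → ∑ Ts (λ y → relations ys * pick (contains? full (span ys) y) (2 ^ k) 1))
        ≡⟨ ∑-cong Ys (λ ys → ∑-*ˡ (relations ys) Ts _) ⟩
      ∑ Ys (λ ys → relations ys * step ys) ∎
    -- Trades the exact factor `2 ^ k` for its approximation `(u / n) ^ N`, at the price of 4/3.
    rescale : ∀ {P : Set} (P? : Dec P) →
      3 * n ^ N * pick P? (2 ^ k) 1 ≤ 4 * pick P? (u ^ N) (n ^ N)
    rescale (yes _) = ≤-trans (≤-reflexive (e₂ (n ^ N) (2 ^ k))) upper
      where
      e₂ : ∀ p q → 3 * p * q ≡ 3 * (q * p)
      e₂ = solve-∀
    rescale (no _)  = ≤-trans (≤-reflexive (*-identityʳ (3 * n ^ N))) (*-monoˡ-≤ (n ^ N) (n≤1+n 3))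
    length-coords : ∀ ys → length (map (span ys) (indices k m)) ≡ N
    length-coords ys = trans (length-map (span ys) (indices k m)) (length-indices k m)
    step-bound : ∀ ys → c * step ys ≤ C
    step-bound ys = *-cancelʳ-≤ _ _ (n ^ N) {{m^n≢0 n N}} (begin
      3 * n ^ T * step ys * n ^ N
        ≡⟨ e₂ (n ^ T) (step ys) (n ^ N) ⟩
      n ^ T * (3 * n ^ N * step ys)
        ≡⟨ cong (n ^ T *_) (sym (∑-*ˡ (3 * n ^ N) Ts _)) ⟩
      n ^ T * ∑ Ts (λ y → 3 * n ^ N * pick (contains? full (span ys) y) (2 ^ k) 1)
        ≤⟨ *-monoʳ-≤ (n ^ T) (∑-mono Ts λ y → rescale (contains? full (span ys) y)) ⟩
      n ^ T * ∑ Ts (λ y → 4 * pick (contains? full (span ys) y) (u ^ N) (n ^ N))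
        ≡⟨ cong (n ^ T *_) (∑-*ˡ 4 Ts _) ⟩
      n ^ T * (4 * ∑ Ts (λ y → pick (contains? full (span ys) y) (u ^ N) (n ^ N)))
        ≤⟨ *-monoʳ-≤ (n ^ T) (*-monoʳ-≤ 4 (containment-bound m full (span ys) u n n≤u lower)) ⟩
      n ^ T * (4 * (M * (m * n ^ N + W)))
        ≡⟨ e₃ (n ^ T) M m (n ^ N) W ⟩
      M * (4 * (m * n ^ T * n ^ N + W * n ^ T))
        ≤⟨ *-monoʳ-≤ M (*-monoʳ-≤ 4 (+-monoʳ-≤ (m * n ^ T * n ^ N)
             (subst (λ l → W * n ^ T ≤ u ^ T * n ^ l) (length-coords ys)
               (weight-full≤ (map (span ys) (indices k m)) n≤u (<⇒≤ t<T))))) ⟩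
      M * (4 * (m * n ^ T * n ^ N + u ^ T * n ^ N))
        ≡⟨ e₄ M (m * n ^ T) (u ^ T) (n ^ N) ⟩
      C * n ^ N ∎)
      where
      W = weight u n full (map (span ys) (indices k m))
      e₂ : ∀ p s q → 3 * p * s * q ≡ p * (3 * q * s)
      e₂ = solve-∀
      e₃ : ∀ p M m q W → p * (4 * (M * (m * q + W))) ≡ M * (4 * (m * p * q + W * p))
      e₃ = solve-∀
      e₄ : ∀ M x y q → M * (4 * (x * q + y * q)) ≡ M * (4 * (x + y)) * q
      e₄ = solve-∀

-- From functions to vectors

length-filterᵇ : (p : A → Bool) (xs : List A) →
  length (filterᵇ p xs) ≡ ∑ xs (λ x → if p x then 1 else 0)
length-filterᵇ p []       = refl
length-filterᵇ p (x ∷ xs) with p x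
... | true  = cong suc (length-filterᵇ p xs)
... | false = length-filterᵇ p xs

consᶠ : ∀ {n} → A → (Fin n → A) → Fin (suc n) → A
consᶠ a f zero    = a
consᶠ a f (suc i) = f i

-- Functions are only compared pointwise (up to _≈_), so sums are transported for extensional g.
∑-allFuns : {A : Set a} {B : Set b} {_≈_ : A → A → Set a} → (∀ {x} → x ≈ x) →
  (xs : List A) (ys : List B) (h : B → A) →
  (∀ (g : A → ℕ) → (∀ {x y} → x ≈ y → g x ≡ g y) → ∑ xs g ≡ ∑ ys (g ∘ h)) →
  ∀ n (g : (Fin n → A) → ℕ) → (∀ {f f′} → (∀ i → f i ≈ f′ i) → g f ≡ g f′) →
  ∑ (allFuns n xs) g ≡ ∑ (vecs n ys) (λ v → g (λ i → h (lookup v i)))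
∑-allFuns ≈-refl xs ys h hyp zero    g ext = cong (_+ 0) (ext λ ())
∑-allFuns {_≈_ = _≈_} ≈-refl xs ys h hyp (suc n) g ext = begin
  ∑ (allFuns (suc n) xs) g
    ≡⟨ ∑-concatMap _ xs g ⟩
  ∑ xs _
    ≡⟨ ∑-cong xs (λ a → trans (∑-map _ (allFuns n xs) g) (∑-cong (allFuns n xs) λ f →
         ext λ { zero → ≈-refl ; (suc i) → ≈-refl })) ⟩
  ∑ xs (λ a → ∑ (allFuns n xs) (λ f → g (consᶠ a f)))
    ≡⟨ ∑-cong xs (λ a → ∑-allFuns ≈-refl xs ys h hyp n (λ f → g (consᶠ a f)) (λ f≈ → ext λ
         { zero → ≈-refl ; (suc i) → f≈ i })) ⟩
  ∑ xs (λ a → ∑ (vecs n ys) (λ v → g (consᶠ a (λ i → h (lookup v i)))))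
    ≡⟨ hyp _ (λ a≈ → ∑-cong (vecs n ys) λ v → ext λ { zero → a≈ ; (suc i) → ≈-refl }) ⟩
  ∑ ys (λ b → ∑ (vecs n ys) (λ v → g (consᶠ (h b) (λ i → h (lookup v i)))))
    ≡⟨ ∑-cong ys (λ b → ∑-cong (vecs n ys) λ v → ext λ { zero → ≈-refl ; (suc i) → ≈-refl }) ⟩
  ∑ ys (λ b → ∑ (vecs n ys) (λ v → g (λ i → h (lookup (b ∷ v) i))))
    ≡⟨ sym (∑-vecs-suc n ys _) ⟩
  ∑ (vecs (suc n) ys) (λ v → g (λ i → h (lookup v i))) ∎
  where open ≡-Reasoning

∑-vecs-vectors : ∀ k (g : Vec Bool k → ℕ) →
  ∑ (vecs k (true ∷ false ∷ [])) g ≡ ∑ (vectors k) g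
∑-vecs-vectors zero    g = refl
∑-vecs-vectors (suc k) g = begin
  ∑ (vecs (suc k) (true ∷ false ∷ [])) g
    ≡⟨ ∑-vecs-suc k (true ∷ false ∷ []) g ⟩
  ∑ Vs (g ∘ (true ∷_)) + (∑ Vs (g ∘ (false ∷_)) + 0)
    ≡⟨ cong (∑ Vs (g ∘ (true ∷_)) +_) (+-identityʳ _) ⟩
  ∑ Vs (g ∘ (true ∷_)) + ∑ Vs (g ∘ (false ∷_))
    ≡⟨ +-comm (∑ Vs (g ∘ (true ∷_))) _ ⟩
  ∑ Vs (g ∘ (false ∷_)) + ∑ Vs (g ∘ (true ∷_))
    ≡⟨ cong₂ _+_ (∑-vecs-vectors k _) (∑-vecs-vectors k _) ⟩
  ∑ (vectors k) (g ∘ (false ∷_)) + ∑ (vectors k) (g ∘ (true ∷_))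
    ≡⟨ sym (∑-vectors-suc k g) ⟩
  ∑ (vectors (suc k)) g ∎
  where
  open ≡-Reasoning
  Vs = vecs k (true ∷ false ∷ [])

rows : ∀ {d} → Vec (Vec Bool k) d → Fin d → Bits k
rows v j = lookup (lookup v j)

∑-samples : ∀ t d k (g : (Fin t → Fin d → Bits k) → ℕ) →
  (∀ {x y} → (∀ i j l → x i j l ≡ y i j l) → g x ≡ g y) →
  ∑ (samples t d k) g ≡ ∑ (vecs t (vecs d (vectors k))) (λ v → g (λ i → rows (lookup v i)))
∑-samples t d k =
  ∑-allFuns {_≈_ = λ x y → ∀ j l → x j l ≡ y j l} (λ _ _ → refl) _ (vecs d (vectors k)) rows
    (∑-allFuns {_≈_ = _≗_} (λ _ → refl) (allBits k) (vectors k) lookup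
      (λ g ext → trans
        (∑-allFuns {_≈_ = _≡_} refl (true ∷ false ∷ []) (true ∷ false ∷ []) (λ b → b)
          (λ _ _ → refl) k g ext)
        (∑-vecs-vectors k (g ∘ lookup)))
      d)
    t

-- Separates the first factors of all `t` summands from the remaining ones and sums over them
-- innermost, which amounts to conditioning on the `y`'s.
∑-vecs-zip : ∀ t (xs : List A) (yss : List (Vec A m)) (g : Vec (Vec A (suc m)) t → ℕ) →
  ∑ (vecs t (concatMap (λ x → map (x ∷_) yss) xs)) g
    ≡ ∑ (vecs t yss) (λ v → ∑ (vecs t xs) (λ u → g (zipWith _∷_ u v)))
∑-vecs-zip zero    xs yss g = cong (_+ 0) (sym (+-identityʳ _))
∑-vecs-zip (suc t) xs yss g = begin
  ∑ (vecs (suc t) xyss) g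
    ≡⟨ ∑-vecs-suc t xyss g ⟩
  ∑ xyss (λ w → ∑ (vecs t xyss) (λ ws → g (w ∷ ws)))
    ≡⟨ ∑-cong xyss (λ w → ∑-vecs-zip t xs yss _) ⟩
  ∑ xyss (λ w → ∑ (vecs t yss) (λ v → ∑ (vecs t xs) (λ u → g (w ∷ zipWith _∷_ u v))))
    ≡⟨ trans (∑-concatMap _ xs _) (∑-cong xs λ x → ∑-map (x ∷_) yss _) ⟩
  ∑ xs (λ x → ∑ yss (λ y → ∑ (vecs t yss) (λ v → ∑ (vecs t xs) (λ u → g ((x ∷ y) ∷ zipWith _∷_ u v)))))
    ≡⟨ ∑-swap xs yss _ ⟩
  ∑ yss (λ y → ∑ xs (λ x → ∑ (vecs t yss) (λ v → ∑ (vecs t xs) (λ u → g ((x ∷ y) ∷ zipWith _∷_ u v)))))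
    ≡⟨ ∑-cong yss (λ y → ∑-swap xs (vecs t yss) _) ⟩
  ∑ yss (λ y → ∑ (vecs t yss) (λ v → ∑ xs (λ x → ∑ (vecs t xs) (λ u → g ((x ∷ y) ∷ zipWith _∷_ u v)))))
    ≡⟨ ∑-cong yss (λ y → ∑-cong (vecs t yss) λ v → sym (∑-vecs-suc t xs _)) ⟩
  ∑ yss (λ y → ∑ (vecs t yss) (λ v → ∑ (vecs (suc t) xs) (λ u → g (zipWith _∷_ u (y ∷ v)))))
    ≡⟨ sym (∑-vecs-suc t yss _) ⟩
  ∑ (vecs (suc t) yss) (λ v → ∑ (vecs (suc t) xs) (λ u → g (zipWith _∷_ u v))) ∎
  where
  open ≡-Reasoning
  xyss = concatMap (λ x → map (x ∷_) yss) xs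

-- Soundness of the Boolean zero test

prodF-cong : ∀ {n} {f g : Fin n → Bool} → f ≗ g → prodF f ≡ prodF g
prodF-cong {zero}  e = refl
prodF-cong {suc n} e = cong₂ _∧_ (e zero) (prodF-cong (e ∘ suc))

sumF-cong : ∀ {n} {f g : Fin n → Bool} → f ≗ g → sumF f ≡ sumF g
sumF-cong {zero}  e = refl
sumF-cong {suc n} e = cong₂ _xor_ (e zero) (sumF-cong (e ∘ suc))

allᵇ-cong : {p q : A → Bool} → p ≗ q → allᵇ p ≗ allᵇ q
allᵇ-cong e []       = refl
allᵇ-cong e (x ∷ xs) = cong₂ _∧_ (e x) (allᵇ-cong e xs)

∧-trueˡ : ∀ {a b} → a ∧ b ≡ true → a ≡ true
∧-trueˡ {true} e = refl

∧-trueʳ : ∀ {a b} → a ∧ b ≡ true → b ≡ true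
∧-trueʳ {true} e = e

allᵇ-++ : (p : A → Bool) (xs ys : List A) → allᵇ p (xs ++ ys) ≡ allᵇ p xs ∧ allᵇ p ys
allᵇ-++ p []       ys = refl
allᵇ-++ p (x ∷ xs) ys = trans (cong (p x ∧_) (allᵇ-++ p xs ys)) (sym (∧-assoc (p x) _ _))

allᵇ-map : (p : B → Bool) (h : A → B) (xs : List A) → allᵇ p (map h xs) ≡ allᵇ (p ∘ h) xs
allᵇ-map p h []       = refl
allᵇ-map p h (x ∷ xs) = cong (p (h x) ∧_) (allᵇ-map p h xs)

allᵇ-concatMap : (p : B → Bool) (h : A → List B) (xs : List A) →
  allᵇ p (concatMap h xs) ≡ allᵇ (λ x → allᵇ p (h x)) xs
allᵇ-concatMap p h []       = refl
allᵇ-concatMap p h (x ∷ xs) =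
  trans (allᵇ-++ p (h x) _) (cong (allᵇ p (h x) ∧_) (allᵇ-concatMap p h xs))

allᵇ-tabulate : ∀ {n} (p : A → Bool) (f : Fin n → A) → allᵇ p (tabulate f) ≡ true → ∀ i → p (f i) ≡ true
allᵇ-tabulate p f e zero    = ∧-trueˡ e
allᵇ-tabulate p f e (suc i) = allᵇ-tabulate p (f ∘ suc) (∧-trueʳ {p (f zero)} e) i

-- The enumeration reaches `f` only up to pointwise equality, so `p` has to respect it.
allᵇ-allFuns : (xs : List A) → (∀ p → allᵇ p xs ≡ true → ∀ a → p a ≡ true) →
  ∀ n (p : (Fin n → A) → Bool) → (∀ {f g} → f ≗ g → p f ≡ p g) →
  allᵇ p (allFuns n xs) ≡ true → ∀ f → p f ≡ true
allᵇ-allFuns xs complete zero    p ext e f = trans (ext λ ()) (∧-trueˡ e)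
allᵇ-allFuns xs complete (suc n) p ext e f =
  trans (ext λ { zero → refl ; (suc i) → refl })
    (allᵇ-allFuns xs complete n (λ g → p (consᶠ (f zero) g))
      (λ e → ext λ { zero → refl ; (suc i) → e i })
      (complete (λ a → allᵇ (λ g → p (consᶠ a g)) (allFuns n xs))
        (trans (sym (trans (allᵇ-concatMap p _ xs) (allᵇ-cong (λ a → trans
          (allᵇ-map p _ (allFuns n xs)) (allᵇ-cong (λ g → ext λ { zero → refl ; (suc i) → refl })
            (allFuns n xs))) xs))) e)
        (f zero))
      (f ∘ suc))

tensorSum-cong : ∀ {d} {x y : Fin t → Fin d → Bits k} {idx idx′ : Fin d → Fin k} →
  (∀ i j l → x i j l ≡ y i j l) → idx ≗ idx′ → tensorSum x idx ≡ tensorSum y idx′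
tensorSum-cong {y = y} e e′ = sumF-cong λ i → prodF-cong λ j → trans (e i j _) (cong (y i j) (e′ j))

isZeroTensor-sound : ∀ {d} (x : Fin t → Fin d → Bits k) → isZeroTensor (tensorSum x) ≡ true →
  ∀ idx → tensorSum x idx ≡ false
isZeroTensor-sound {k = k} {d} x e idx = not-injective (allᵇ-allFuns (allFin k)
  (λ p → allᵇ-tabulate p _) d (λ idx → not (tensorSum x idx))
  (λ e′ → cong not (tensorSum-cong {x = x} {x} (λ _ _ _ → refl) e′)) e idx)

tensor-⨂ : (y : Vec (Vec Bool k) m) (l : Vec (Fin k) m) → tensor (rows y) (lookup l) ≡ ⨂ y l
tensor-⨂ []      []      = refl
tensor-⨂ (x ∷ y) (i ∷ l) = cong (lookup x i ∧_) (tensor-⨂ y l)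

tensorSum-combination : (xs : Vec (Vec Bool k) t) (ys : Vec (Vec (Vec Bool k) m) t) → ∀ i l →
  tensorSum (λ s → rows (lookup (zipWith _∷_ xs ys) s)) (lookup (i ∷ l)) ≡ combination ys (column i xs) l
tensorSum-combination []       []       i l = refl
tensorSum-combination (x ∷ xs) (y ∷ ys) i l =
  cong₂ _xor_ (cong (lookup x i ∧_) (tensor-⨂ y l)) (tensorSum-combination xs ys i l)

zeroCount≤total : ∀ t m k → zeroCount t (suc m) k ≤ total t m k
zeroCount≤total t m k = begin
  zeroCount t (suc m) k
    ≡⟨ length-filterᵇ _ (samples t (suc m) k) ⟩
  ∑ (samples t (suc m) k) vanishes
    ≡⟨ ∑-samples t (suc m) k vanishes (λ e → cong (λ b → if b then 1 else 0)
         (allᵇ-cong (λ idx → cong not (tensorSum-cong {idx = idx} {idx} e (λ _ → refl))) (allIndices (suc m) k))) ⟩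
  ∑ (vecs t (vecs (suc m) (vectors k))) (λ v → vanishes (λ i → rows (lookup v i)))
    ≡⟨ ∑-vecs-zip t (vectors k) (vecs m (vectors k)) _ ⟩
  ∑ (vecs t (vecs m (vectors k))) (λ ys → ∑ (vecs t (vectors k)) (λ xs →
    vanishes (λ i → rows (lookup (zipWith _∷_ xs ys) i))))
    ≤⟨ ∑-mono (vecs t (vecs m (vectors k))) (λ ys → ∑-mono (vecs t (vectors k)) λ xs →
         vanishes≤ xs ys) ⟩
  total t m k ∎
  where
  open ≤-Reasoning
  vanishes : (Fin t → Fin (suc m) → Bits k) → ℕ
  vanishes x = if isZeroTensor (tensorSum x) then 1 else 0
  vanishes≤ : (xs : Vec (Vec Bool k) t) (ys : Vec (Vec (Vec Bool k) m) t) →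
    vanishes (λ i → rows (lookup (zipWith _∷_ xs ys) i)) ≤ pick (relation? xs ys) 1 0
  vanishes≤ xs ys with isZeroTensor (tensorSum (λ i → rows (lookup (zipWith _∷_ xs ys) i))) in e
                     | relation? xs ys
  ... | false | _      = z≤n
  ... | true  | yes _  = ≤-refl
  ... | true  | no ¬R  = contradiction
    (λ i l → trans (sym (tensorSum-combination xs ys i l))
      (isZeroTensor-sound (λ i → rows (lookup (zipWith _∷_ xs ys) i)) e (lookup (i ∷ l)))) ¬R

-- Approximate roots and the final estimate

module _ where
  open ≤-Reasoning

  last-power : ∀ N X j a → a ^ N ≤ X → X < (a + j) ^ N → ∃ λ u → a ≤ u × u ^ N ≤ X × X < suc u ^ N
  last-power N X zero    a le gt = contradiction le (<⇒≱ (subst (λ z → X < z ^ N) (+-identityʳ a) gt))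
  last-power N X (suc j) a le gt with suc a ^ N ≤? X
  ... | no  ≰X = a , ≤-refl , le , ≰⇒> ≰X
  ... | yes ≤X with u , a<u , rest ← last-power N X j (suc a) ≤X (subst (λ z → X < z ^ N) (+-suc a j) gt)
    = u , <⇒≤ a<u , rest

  -- A form of Bernoulli's inequality, `(1 + 1/u) ^ j ≤ u / (u - j)`. The induction keeps `u` fixed:
  -- one factor is traded by `v * (u + 1) ≤ u * (v + 1)`, with `j` going down and `v` up.
  suc-^-bound : ∀ j v → let u = j + v in v * suc u ^ j ≤ u ^ suc j
  suc-^-bound zero    v = ≤-refl
  suc-^-bound (suc j) v = begin
    v * (suc u * suc u ^ j)
      ≡⟨ sym (*-assoc v (suc u) _) ⟩
    v * suc u * suc u ^ j
      ≤⟨ *-monoˡ-≤ (suc u ^ j) (begin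
           v * suc u ≡⟨ *-suc v u ⟩
           v + v * u ≤⟨ +-mono-≤ (m≤n+m v (suc j)) (≤-reflexive (*-comm v u)) ⟩
           u + u * v ≡⟨ sym (*-suc u v) ⟩
           u * suc v ∎) ⟩
    u * suc v * suc u ^ j
      ≡⟨ *-assoc u (suc v) _ ⟩
    u * (suc v * suc u ^ j)
      ≤⟨ *-monoʳ-≤ u (subst (λ w → suc v * suc w ^ j ≤ w ^ suc j) (+-suc j v) (suc-^-bound j (suc v))) ⟩
    u * u ^ suc j ∎
    where u = suc j + v

  -- u / n approximates the N-th root of 2 ^ k from below.
  root-approximation : ∀ k N .{{_ : NonZero N}} → ∃ λ u → ∃ λ n →
    NonZero n × n ≤ u × u ^ N ≤ 2 ^ k * n ^ N × 3 * (2 ^ k * n ^ N) ≤ 4 * u ^ N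
  root-approximation k N = u , n , n≢0 , n≤u , lower , *-cancelˡ-≤ u {{u≢0}} (begin
    u * (3 * X)
      ≤⟨ *-monoʳ-≤ u (*-monoʳ-≤ 3 (<⇒≤ upper)) ⟩
    u * (3 * suc u ^ N)
      ≡⟨ e₁ u (suc u ^ N) ⟩
    3 * u * suc u ^ N
      ≤⟨ *-monoˡ-≤ (suc u ^ N) 3u≤4v ⟩
    4 * v * suc u ^ N
      ≡⟨ *-assoc 4 v _ ⟩
    4 * (v * suc u ^ N)
      ≤⟨ *-monoʳ-≤ 4 (subst (λ w → v * suc w ^ N ≤ w ^ suc N) N+v≡u (suc-^-bound N v)) ⟩
    4 * (u * u ^ N)
      ≡⟨ x∙yz≈y∙xz 4 u _ ⟩
    u * (4 * u ^ N) ∎)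
    where
    -- With `u ≥ n = 4 * N`, passing from `u` to `u + 1` changes the `N`-th power by a factor of at
    -- most `u / (u - N) ≤ 4/3`.
    n = 4 * N
    X = 2 ^ k * n ^ N
    n≢0 : NonZero n
    n≢0 = m*n≢0 4 N
    root = last-power N X (suc X) n
      (m≤n*m (n ^ N) (2 ^ k) {{m^n≢0 2 k}})
      (begin
        suc X           ≤⟨ m≤n+m (suc X) n ⟩
        n + suc X       ≡⟨ sym (^-identityʳ _) ⟩
        (n + suc X) ^ 1 ≤⟨ ^-monoʳ-≤ (n + suc X) {{>-nonZero (≤-trans (s≤s z≤n) (m≤n+m (suc X) n))}} (>-nonZero⁻¹ N) ⟩
        (n + suc X) ^ N ∎)
    u = proj₁ root
    n≤u = proj₁ (proj₂ root)
    lower = proj₁ (proj₂ (proj₂ root))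
    upper = proj₂ (proj₂ (proj₂ root))
    u≢0 : NonZero u
    u≢0 = >-nonZero (≤-trans (>-nonZero⁻¹ n {{n≢0}}) n≤u)
    N≤u : N ≤ u
    N≤u = ≤-trans (m≤n*m N 4) n≤u
    v = proj₁ (m≤n⇒∃[o]m+o≡n N≤u)
    N+v≡u : N + v ≡ u
    N+v≡u = proj₂ (m≤n⇒∃[o]m+o≡n N≤u)
    3u≤4v : 3 * u ≤ 4 * v
    3u≤4v = +-cancelʳ-≤ u _ _ (begin
      3 * u + u     ≡⟨ e₂ u ⟩
      4 * u         ≡⟨ cong (4 *_) (sym N+v≡u) ⟩
      4 * (N + v)   ≡⟨ e₃ N v ⟩
      4 * v + n     ≤⟨ +-monoʳ-≤ (4 * v) n≤u ⟩
      4 * v + u ∎)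
      where
      e₂ : ∀ u → 3 * u + u ≡ 4 * u
      e₂ = solve-∀
      e₃ : ∀ N v → 4 * (N + v) ≡ 4 * v + 4 * N
      e₃ = solve-∀
    e₁ : ∀ u x → u * (3 * x) ≡ 3 * u * x
    e₁ = solve-∀

  ^-sum-bound : ∀ e x y {Z} → x ^ e ≤ Z → y ^ e ≤ Z → (x + y) ^ e ≤ 2 ^ e * Z
  ^-sum-bound e x y {Z} x≤ y≤ = [ (λ x≤y → bound x≤y ≤-refl y≤) , (λ y≤x → bound ≤-refl y≤x x≤) ]′ (≤-total x y)
    where
    bound : ∀ {z} → x ≤ z → y ≤ z → z ^ e ≤ Z → (x + y) ^ e ≤ 2 ^ e * Z
    bound {z} x≤z y≤z z≤ = begin
      (x + y) ^ e   ≤⟨ ^-monoˡ-≤ e (+-mono-≤ x≤z y≤z) ⟩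
      (z + z) ^ e   ≡⟨ cong (λ w → (z + w) ^ e) (sym (+-identityʳ z)) ⟩
      (2 * z) ^ e   ≡⟨ ^-distribʳ-* 2 z e ⟩
      2 ^ e * z ^ e ≤⟨ *-monoʳ-≤ (2 ^ e) z≤ ⟩
      2 ^ e * Z ∎

  ratio-^-mono : ∀ {u n e f Y} .{{_ : NonZero n}} → n ≤ u → e ≤ f → u ^ f ≤ Y * n ^ f → u ^ e ≤ Y * n ^ e
  ratio-^-mono {u} {n} {e} {f} {Y} n≤u e≤f bound with g , refl ← m≤n⇒∃[o]m+o≡n e≤f =
    *-cancelʳ-≤ _ _ (n ^ g) {{m^n≢0 n g}} (begin
      u ^ e * n ^ g       ≤⟨ *-monoʳ-≤ (u ^ e) (^-monoˡ-≤ g n≤u) ⟩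
      u ^ e * u ^ g       ≡⟨ sym (^-distribˡ-+-* u e g) ⟩
      u ^ (e + g)         ≤⟨ bound ⟩
      Y * n ^ (e + g)     ≡⟨ cong (Y *_) (^-distribˡ-+-* n e g) ⟩
      Y * (n ^ e * n ^ g) ≡⟨ sym (*-assoc Y _ _) ⟩
      Y * n ^ e * n ^ g ∎)

  -- Constants are absorbed because 4 ^ 3 ≤ 3 ^ 2 * 2 ^ 3.
  factor-bound : ∀ q x y s Y → 2 ^ (5 * q) ≤ Y → x ^ (5 * q) ≤ Y * s ^ (5 * q) → y ^ (5 * q) ≤ Y * s ^ (5 * q) →
    (4 * (x + y)) ^ (2 * q) ≤ (3 * s) ^ (2 * q) * Y
  factor-bound q x y s Y hY hx hy = ^-cancelʳ-≤ 5 (begin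
    ((4 * z) ^ (2 * q)) ^ 5
      ≡⟨ trans (^-*-assoc (4 * z) (2 * q) 5) (cong ((4 * z) ^_) (e₁ q)) ⟩
    (4 * z) ^ (e * 2)
      ≡⟨ trans (^-distribʳ-* 4 z (e * 2)) (cong (4 ^ (e * 2) *_) (sym (^-*-assoc z e 2))) ⟩
    4 ^ (e * 2) * (z ^ e) ^ 2
      ≤⟨ *-monoʳ-≤ (4 ^ (e * 2)) (^-monoˡ-≤ 2 (^-sum-bound e x y hx hy)) ⟩
    4 ^ (e * 2) * (2 ^ e * (Y * S)) ^ 2
      ≡⟨ e₂ (4 ^ (e * 2)) (2 ^ e) Y S ⟩
    4 ^ (e * 2) * (2 ^ e) ^ 2 * (Y ^ 2 * S ^ 2)
      ≤⟨ *-monoˡ-≤ (Y ^ 2 * S ^ 2) slack ⟩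
    (3 ^ e) ^ 2 * (2 ^ e) ^ 3 * (Y ^ 2 * S ^ 2)
      ≤⟨ *-monoˡ-≤ (Y ^ 2 * S ^ 2) (*-monoʳ-≤ ((3 ^ e) ^ 2) (^-monoˡ-≤ 3 hY)) ⟩
    (3 ^ e) ^ 2 * Y ^ 3 * (Y ^ 2 * S ^ 2)
      ≡⟨ e₃ (3 ^ e) Y S ⟩
    (3 ^ e * S) ^ 2 * Y ^ 5
      ≡⟨ cong (λ w → w ^ 2 * Y ^ 5) (sym (^-distribʳ-* 3 s e)) ⟩
    ((3 * s) ^ e) ^ 2 * Y ^ 5
      ≡⟨ cong (_* Y ^ 5) (trans (^-*-assoc (3 * s) e 2) (trans (cong ((3 * s) ^_) (sym (e₁ q)))
           (sym (^-*-assoc (3 * s) (2 * q) 5)))) ⟩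
    ((3 * s) ^ (2 * q)) ^ 5 * Y ^ 5
      ≡⟨ sym (^-distribʳ-* ((3 * s) ^ (2 * q)) Y 5) ⟩
    ((3 * s) ^ (2 * q) * Y) ^ 5 ∎)
    where
    z = x + y
    e = 5 * q
    S = s ^ e
    e₁ : ∀ q → 2 * q * 5 ≡ 5 * q * 2
    e₁ = solve-∀
    e₂ : ∀ F T Y S → F * (T * (Y * S) * (T * (Y * S) * 1)) ≡ F * (T * (T * 1)) * (Y * (Y * 1) * (S * (S * 1)))
    e₂ = solve-∀
    e₃ : ∀ R Y S → R * (R * 1) * (Y * (Y * (Y * 1))) * (Y * (Y * 1) * (S * (S * 1)))
      ≡ R * S * (R * S * 1) * (Y * (Y * (Y * (Y * (Y * 1)))))
    e₃ = solve-∀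
    slack : 4 ^ (e * 2) * (2 ^ e) ^ 2 ≤ (3 ^ e) ^ 2 * (2 ^ e) ^ 3
    slack = begin
      4 ^ (e * 2) * (2 ^ e) ^ 2
        ≡⟨ cong₂ _*_ (trans (cong (4 ^_) (*-comm e 2)) (sym (^-*-assoc 4 2 e))) (^-comm 2 e 2) ⟩
      16 ^ e * 4 ^ e
        ≡⟨ sym (^-distribʳ-* 16 4 e) ⟩
      64 ^ e
        ≤⟨ ^-monoˡ-≤ e (≤ᵇ⇒≤ 64 72 tt) ⟩
      72 ^ e
        ≡⟨ ^-distribʳ-* 9 8 e ⟩
      9 ^ e * 8 ^ e
        ≡⟨ cong₂ _*_ (^-comm 3 2 e) (^-comm 2 3 e) ⟩
      (3 ^ e) ^ 2 * (2 ^ e) ^ 3 ∎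

-- `total-bound` at `T = t`, raised to the power `2 * q`. Each summand contributes `M = 2 ^ (k * m)`
-- and a factor absorbed into `Y`; the extra `2 ^ (2 * q * k * t)` completes `k * m` to `k * suc m`.
power-bound : ∀ p q m t {zc u n} .{{_ : NonZero k}} → zc ≤ total t m k → .{{n≢0 : NonZero n}} →
  n ≤ u → u ^ k ^ m ≤ 2 ^ k * n ^ k ^ m → 3 * (2 ^ k * n ^ k ^ m) ≤ 4 * u ^ k ^ m →
  suc m ^ (5 * q) < 2 ^ (p * k) → 5 * q * t < p * k ^ m →
  zc ^ (2 * q) * 2 ^ (2 * q * k * t) ≤ 2 ^ (2 * q * k * suc m * t) * 2 ^ (p * k * t)
power-bound {k} p q m t {zc} {u} {n} zc≤total {{n≢0}} n≤u lower upper d-small t-small = begin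
  zc ^ (2 * q) * 2 ^ (2 * q * k * t)
    ≤⟨ *-monoˡ-≤ (2 ^ (2 * q * k * t)) (*-cancelˡ-≤ (((3 * nᵗ) ^ t) ^ (2 * q)) {{cancellable}} (begin
      ((3 * nᵗ) ^ t) ^ (2 * q) * zc ^ (2 * q)
        ≡⟨ sym (^-distribʳ-* ((3 * nᵗ) ^ t) zc (2 * q)) ⟩
      ((3 * nᵗ) ^ t * zc) ^ (2 * q)
        ≤⟨ ^-monoˡ-≤ (2 * q) (≤-trans (*-monoʳ-≤ ((3 * nᵗ) ^ t) zc≤total)
             (total-bound {t = t} m n≤u lower upper ≤-refl)) ⟩
      ((M * C) ^ t) ^ (2 * q)
        ≡⟨ ^-comm (M * C) t (2 * q) ⟩
      ((M * C) ^ (2 * q)) ^ t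
        ≤⟨ factor^t t refl ⟩
      (M ^ (2 * q) * ((3 * nᵗ) ^ (2 * q) * Y)) ^ t
        ≡⟨ trans (^-distribʳ-* (M ^ (2 * q)) _ t) (cong ((M ^ (2 * q)) ^ t *_)
             (trans (^-distribʳ-* ((3 * nᵗ) ^ (2 * q)) Y t) (cong (_* Y ^ t) (^-comm (3 * nᵗ) (2 * q) t)))) ⟩
      (M ^ (2 * q)) ^ t * (((3 * nᵗ) ^ t) ^ (2 * q) * Y ^ t)
        ≡⟨ x∙yz≈y∙xz ((M ^ (2 * q)) ^ t) (((3 * nᵗ) ^ t) ^ (2 * q)) (Y ^ t) ⟩
      ((3 * nᵗ) ^ t) ^ (2 * q) * ((M ^ (2 * q)) ^ t * Y ^ t) ∎)) ⟩
  (M ^ (2 * q)) ^ t * Y ^ t * 2 ^ (2 * q * k * t)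
    ≡⟨ cong₂ (λ y z → y * z * 2 ^ (2 * q * k * t)) M-power (^-*-assoc 2 (p * k) t) ⟩
  2 ^ (k * m * (2 * q) * t) * 2 ^ (p * k * t) * 2 ^ (2 * q * k * t)
    ≡⟨ e₁ (2 ^ (k * m * (2 * q) * t)) (2 ^ (p * k * t)) (2 ^ (2 * q * k * t)) ⟩
  2 ^ (k * m * (2 * q) * t) * 2 ^ (2 * q * k * t) * 2 ^ (p * k * t)
    ≡⟨ cong (_* 2 ^ (p * k * t)) (trans (sym (^-distribˡ-+-* 2 (k * m * (2 * q) * t) _))
         (cong (2 ^_) (e₂ q k m t))) ⟩
  2 ^ (2 * q * k * suc m * t) * 2 ^ (p * k * t) ∎
  where
  open ≤-Reasoning
  nᵗ = n ^ t
  M = (2 ^ k) ^ m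
  Y = 2 ^ (p * k)
  C = 4 * (m * nᵗ + u ^ t)
  M-power : (M ^ (2 * q)) ^ t ≡ 2 ^ (k * m * (2 * q) * t)
  M-power = trans (cong (λ z → (z ^ (2 * q)) ^ t) (^-*-assoc 2 k m))
    (trans (cong (_^ t) (^-*-assoc 2 (k * m) (2 * q))) (^-*-assoc 2 (k * m * (2 * q)) t))
  e₁ : ∀ x y z → x * y * z ≡ x * z * y
  e₁ = solve-∀
  e₂ : ∀ q k m t → k * m * (2 * q) * t + 2 * q * k * t ≡ 2 * q * k * suc m * t
  e₂ = solve-∀
  cancellable : NonZero (((3 * nᵗ) ^ t) ^ (2 * q))
  cancellable = m^n≢0 ((3 * nᵗ) ^ t) (2 * q) {{m^n≢0 (3 * nᵗ) t {{m*n≢0 3 nᵗ {{_}} {{m^n≢0 n t}}}}}}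
  -- That `2 ≤ 2 ^ (εk/5)` follows from the bound on `d` when `d ≥ 2`; for `d = 1` it comes from
  -- `1 ≤ t` and the bound on `t`.
  2^5q≤Y : ∀ m t′ → t ≡ suc t′ → suc m ^ (5 * q) < 2 ^ (p * k) → 5 * q * t < p * k ^ m → 2 ^ (5 * q) ≤ Y
  2^5q≤Y zero t′ refl _ t-small = ^-monoʳ-≤ 2 (begin
    5 * q           ≤⟨ m≤m*n (5 * q) t ⟩
    5 * q * t       ≤⟨ <⇒≤ t-small ⟩
    p * 1           ≤⟨ *-monoʳ-≤ p (>-nonZero⁻¹ k) ⟩
    p * k ∎)
  2^5q≤Y (suc m) t′ _ d-small _ = ≤-trans (^-monoˡ-≤ (5 * q) (s≤s (s≤s z≤n))) (<⇒≤ d-small)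
  -- `t = 0` is set apart: with `d = 1` the hypotheses then do not yield `2 ^ (5 * q) ≤ Y`, but both
  -- sides are empty powers.
  factor^t : ∀ t′ → t ≡ t′ → ((M * C) ^ (2 * q)) ^ t′ ≤ (M ^ (2 * q) * ((3 * nᵗ) ^ (2 * q) * Y)) ^ t′
  factor^t zero    _  = ≤-refl
  factor^t (suc t′) eq = ^-monoˡ-≤ (suc t′) (begin
    (M * C) ^ (2 * q)
      ≡⟨ ^-distribʳ-* M C (2 * q) ⟩
    M ^ (2 * q) * C ^ (2 * q)
      ≤⟨ *-monoʳ-≤ (M ^ (2 * q)) (factor-bound q (m * nᵗ) (u ^ t) nᵗ Y (2^5q≤Y m t′ eq d-small t-small)
           (begin
             (m * nᵗ) ^ (5 * q)         ≡⟨ ^-distribʳ-* m nᵗ (5 * q) ⟩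
             m ^ (5 * q) * nᵗ ^ (5 * q) ≤⟨ *-monoˡ-≤ (nᵗ ^ (5 * q)) (≤-trans (^-monoˡ-≤ (5 * q) (n≤1+n m)) (<⇒≤ d-small)) ⟩
             Y * nᵗ ^ (5 * q) ∎)
           (begin
             (u ^ t) ^ (5 * q)     ≡⟨ trans (^-*-assoc u t (5 * q)) (cong (u ^_) (*-comm t (5 * q))) ⟩
             u ^ (5 * q * t)       ≤⟨ ratio-^-mono {Y = Y} n≤u (<⇒≤ t-small) p-th-power ⟩
             Y * n ^ (5 * q * t)   ≡⟨ cong (Y *_) (trans (cong (n ^_) (*-comm (5 * q) t)) (sym (^-*-assoc n t (5 * q)))) ⟩
             Y * nᵗ ^ (5 * q) ∎)) ⟩
    M ^ (2 * q) * ((3 * nᵗ) ^ (2 * q) * Y) ∎)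
    where
    p-th-power : u ^ (p * k ^ m) ≤ Y * n ^ (p * k ^ m)
    p-th-power = begin
      u ^ (p * k ^ m)                 ≡⟨ trans (cong (u ^_) (*-comm p _)) (sym (^-*-assoc u (k ^ m) p)) ⟩
      (u ^ k ^ m) ^ p                 ≤⟨ ^-monoˡ-≤ p lower ⟩
      (2 ^ k * n ^ k ^ m) ^ p         ≡⟨ ^-distribʳ-* (2 ^ k) _ p ⟩
      (2 ^ k) ^ p * (n ^ k ^ m) ^ p   ≡⟨ cong₂ _*_ (trans (^-*-assoc 2 k p) (cong (2 ^_) (*-comm k p)))
                                           (trans (^-*-assoc n (k ^ m) p) (cong (n ^_) (*-comm _ p))) ⟩
      Y * n ^ (p * k ^ m) ∎

-- Here ε = p / q. The bound on `d` is raised to the power `5 * q` and the conclusion to the power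
-- `2 * q`, with the `2 ^ (k * d * t)` samples as common denominator. Both hypotheses are strict, so
-- a real ε can be replaced by a slightly smaller rational one.
theorem3p4 : (p q : ℕ) → 1 ≤ p → 1 ≤ q → (d k t : ℕ) → 1 ≤ d →
    d ^ (5 * q) < 2 ^ (p * k) →
    5 * q * t < p * k ^ (d ∸ 1) →
    zeroCount t d k ^ (2 * q) * 2 ^ (2 * q * k * t)
    ≤ 2 ^ (2 * q * k * d * t) * 2 ^ (p * k * t)
theorem3p4 p q _ _ (suc m) zero t _ d-small _ = contradiction
  (subst (λ e → suc m ^ (5 * q) < 2 ^ e) (*-zeroʳ p) d-small) (≤⇒≯ (m^n>0 (suc m) (5 * q)))
theorem3p4 p q _ _ (suc m) (suc k) t _ =
  let u , n , n≢0 , n≤u , lower , upper = root-approximation (suc k) (suc k ^ m) {{m^n≢0 (suc k) m}}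
  in  power-bound p q m t (zeroCount≤total t m (suc k)) {{n≢0 = n≢0}} n≤u lower upper
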